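{- The following decision problem is in $\mathsf{P}$ (solvable in time polynomial in $n$): given a Dyck path $d$ of length $n$ and a weight $\alpha\in\mathbb{N}^n$, decide whether the coefficient $c^d_\alpha$ of $\mathbf{x}^\alpha$ in $X_{G(d)}$ is nonzero.
   Context: A Dyck path $d$ of length $n$ is a lattice path from $(0,0)$ to $(n,n)$ with steps $\mathsf{n}=(0,1)$ and $\mathsf{e}=(1,0)$ not going below $y=x$; it is input as a string of length $2n$ in the letters $\mathsf{n},\mathsf{e}$. Its Hessenberg function is: $h_d(i)$ is the number of $\mathsf n$ steps preceding the $i$-th $\mathsf e$ step. The indifference graph $G(d)$ has vertex set $[n]$ with an edge between $i<j$ iff $j\le h_d(i)$. For a graph $G$, $X_G=\sum_f\prod_{v\in V(G)}x_{f(v)}$, summed over all proper colorings $f:V(G)\to\{1,2,\ldots\}$ (adjacent vertices get different colors). Write $X_{G(d)}=\sum_\alpha c^d_\alpha\mathbf{x}^\alpha$, so $c^d_\alpha$ is the number of proper colorings of $G(d)$ with exactly $\alpha_i$ vertices of color $i$ for each $i$. -}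

module Defs where

open import Data.Fin using (Fin; toℕ)
import Data.Fin.Properties as Fin
open import Data.List using (List; []; _∷_; _∷ʳ_; _++_; map; concatMap; length; filter;
  take; allFin; cartesianProductWith)
open import Data.Nat using (ℕ; zero; suc; _+_; _*_; _^_; _≤_; _<_; _<?_)
import Data.Nat.Properties as ℕ
open import Data.Nat.Binary using (ℕᵇ; zero; 2[1+_]; 1+[2_]; fromℕ)
open import Data.Product using (∃-syntax; _×_; _,_)
open import Data.Sum using (_⊎_; inj₁; inj₂; map₂; swap)
open import Data.Vec using (Vec; []; _∷_; lookup; tabulate; count; replicate; toList; zipWith)
import Data.Vec as Vec
import Data.Vec.Properties as Vec
open import Function.Bundles using (_↔_; _⇔_)
open import Function.Definitions using (Injective)
open import Relation.Binary.Definitions using (Decidable; Symmetric; Irreflexive; DecidableEquality)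
open import Relation.Binary.PropositionalEquality using (_≡_; _≢_; refl)
open import Relation.Nullary.Decidable using (Dec; yes; no; _×-dec_; _⊎-dec_; _→-dec_; ¬?)

------------------------------------------------------------------------
-- Dyck paths

data Step : Set where
  𝗇 𝖾 : Step

_≟ˢ_ : DecidableEquality Step
𝗇 ≟ˢ 𝗇 = yes refl
𝗇 ≟ˢ 𝖾 = no λ ()
𝖾 ≟ˢ 𝗇 = no λ ()
𝖾 ≟ˢ 𝖾 = yes refl

#[_] : Step → List Step → ℕ
#[ s ] p = length (filter (_≟ˢ s) p)

-- After k steps the path is at the point (#[ 𝖾 ] (take k steps) , #[ 𝗇 ] (take k steps)).
record DyckPath (n : ℕ) : Set where
  field
    steps    : List Step
    norths   : #[ 𝗇 ] steps ≡ n
    easts    : #[ 𝖾 ] steps ≡ n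
    diagonal : ∀ k → #[ 𝖾 ] (take k steps) ≤ #[ 𝗇 ] (take k steps)

open DyckPath public

-- hessenberg p i is the number of 𝗇 steps preceding the (i+1)-st 𝖾 step of p:
-- vertices and 𝖾 steps are indexed from 0.  If p has at most i 𝖾 steps the
-- value is junk; this does not happen for a Dyck path of length n and i < n.
hessenberg : List Step → ℕ → ℕ
hessenberg []      _       = 0
hessenberg (𝗇 ∷ p) i       = suc (hessenberg p i)
hessenberg (𝖾 ∷ p) zero    = 0
hessenberg (𝖾 ∷ p) (suc i) = hessenberg p i

------------------------------------------------------------------------
-- Graphs and coefficients of the chromatic symmetric function

record Graph (n : ℕ) : Set₁ where
  field
    Adj    : Fin n → Fin n → Set
    adj?   : Decidable Adj
    sym    : Symmetric Adj
    irrefl : Irreflexive _≡_ Adj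

open Graph public using (Adj; adj?)

-- With 1-based i < j the condition for an edge is j ≤ h(i); shifting both
-- indices down by one (but not the value of h) turns it into j < h(i).
Edge : ∀ {n} → DyckPath n → Fin n → Fin n → Set
Edge d i j = toℕ i < toℕ j × toℕ j < hessenberg (steps d) (toℕ i)

edge? : ∀ {n} (d : DyckPath n) → Decidable (Edge d)
edge? d i j = (toℕ i <? toℕ j) ×-dec (toℕ j <? hessenberg (steps d) (toℕ i))

indifferenceGraph : ∀ {n} → DyckPath n → Graph n
indifferenceGraph d = record
  { Adj    = λ i j → Edge d i j ⊎ Edge d j i
  ; adj?   = λ i j → edge? d i j ⊎-dec edge? d j i
  ; sym    = swap
  ; irrefl = λ { refl (inj₁ (i<i , _)) → ℕ.<-irrefl refl i<i
               ; refl (inj₂ (i<i , _)) → ℕ.<-irrefl refl i<i }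
  }

-- A colouring of n vertices with k colours; entry v is the colour of vertex v.
Coloring : ℕ → ℕ → Set
Coloring n k = Vec (Fin k) n

allColorings : ∀ n k → List (Coloring n k)
allColorings zero    k = [] ∷ []
allColorings (suc n) k = cartesianProductWith _∷_ (allFin k) (allColorings n k)

Proper : ∀ {n k} → Graph n → Coloring n k → Set
Proper G f = ∀ u v → Adj G u v → lookup f u ≢ lookup f v

proper? : ∀ {n k} (G : Graph n) (f : Coloring n k) → Dec (Proper G f)
proper? G f = Fin.all? λ u → Fin.all? λ v →
  adj? G u v →-dec ¬? (lookup f u Fin.≟ lookup f v)

-- The exponent vector of the monomial ∏ᵥ x_{f(v)}.
weight : ∀ {n k} → Coloring n k → Vec ℕ k
weight f = tabulate λ c → count (c Fin.≟_) f

-- The coefficient of x₁^α₁ ⋯ x_k^α_k in X_G.  The colours of X_G range over all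
-- positive integers, but a colouring using a colour beyond k contributes a
-- monomial divisible by the corresponding variable, hence different from this
-- one; so only the colourings with colours in Fin k are counted.
coefficient : ∀ {n k} → Graph n → Vec ℕ k → ℕ
coefficient {n} {k} G α =
  length (filter (λ f → proper? G f ×-dec Vec.≡-dec ℕ._≟_ (weight f) α) (allColorings n k))

------------------------------------------------------------------------
-- Deterministic multitape Turing machines

Finite : Set → Set
Finite A = ∃[ m ] (A ↔ Fin m)

data Move : Set where
  left stay right : Move

data Verdict : Set where
  accept reject : Verdict

-- There are 1 + extraTapes two-way infinite tapes, all readable and writable.
-- The transition function either halts with a verdict (this plays the role of
-- the accepting and rejecting halting states), or gives the new state and, for
-- each tape, the symbol to write and the head movement.
record TM (Input : Set) : Set₁ where
  field
    Symbol          : Set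
    symbol-finite   : Finite Symbol
    blank           : Symbol
    input           : Input → Symbol
    input-injective : Injective _≡_ _≡_ input
    input≢blank     : ∀ a → input a ≢ blank
    State           : Set
    state-finite    : Finite State
    start           : State
    extraTapes      : ℕ
    δ               : State → Vec Symbol (suc extraTapes) →
                      Verdict ⊎ (State × Vec (Symbol × Move) (suc extraTapes))

module Run {Input : Set} (M : TM Input) where
  open TM M

  -- before lists the cells to the left of the head, nearest first; after those
  -- to its right, nearest first.  All cells not listed are blank.
  record Tape : Set where
    constructor tape
    field
      before : List Symbol
      head   : Symbol
      after  : List Symbol

  open Tape public

  move : Move → Tape → Tape
  move stay  t                  = t
  move left  (tape []      h r) = tape [] blank (h ∷ r)
  move left  (tape (x ∷ l) h r) = tape l x (h ∷ r)
  move right (tape l h [])      = tape (h ∷ l) blank []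
  move right (tape l h (x ∷ r)) = tape (h ∷ l) x r

  act : Symbol × Move → Tape → Tape
  act (a , m) t = move m (record t { head = a })

  record Config : Set where
    constructor config
    field
      state : State
      tapes : Vec Tape (suc extraTapes)

  open Config public

  next : Config → Verdict ⊎ Config
  next (config q ts) =
    map₂ (λ { (q′ , as) → config q′ (zipWith act as ts) }) (δ q (Vec.map head ts))

  blankTape : Tape
  blankTape = tape [] blank []

  inputTape : List Input → Tape
  inputTape []      = blankTape
  inputTape (a ∷ w) = tape [] (input a) (map input w)

  initial : List Input → Config
  initial w = config start (inputTape w ∷ replicate extraTapes blankTape)

  -- c ⇓[ t ] v : started in c, the machine halts with verdict v after t steps.
  data _⇓[_]_ : Config → ℕ → Verdict → Set where
    halts : ∀ {c v} → next c ≡ inj₁ v → c ⇓[ 0 ] v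
    moves : ∀ {c c′ t v} → next c ≡ inj₂ c′ → c′ ⇓[ t ] v → c ⇓[ suc t ] v

-- M halts on every input word, and accepts exactly the words in L.
Decides : ∀ {Input} → TM Input → (List Input → Set) → Set
Decides M L = ∀ w → ∃[ t ] ∃[ v ] (initial w ⇓[ t ] v × (v ≡ accept ⇔ L w))
  where open Run M

-- On the words word x the running time of M is polynomial in size x.
PolynomialTime : ∀ {Input I : Set} → TM Input → (word : I → List Input) → (size : I → ℕ) → Set
PolynomialTime M word size =
  ∃[ a ] ∃[ b ] ∀ x → ∃[ t ] ∃[ v ] (initial (word x) ⇓[ t ] v × t ≤ a * size x ^ b + a)
  where open Run M

------------------------------------------------------------------------
-- The nonvanishing problem

record Instance : Set where
  constructor inst
  field
    n : ℕ
    d : DyckPath n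
    α : Vec ℕ n

open Instance public

Nonvanishing : Instance → Set
Nonvanishing x = coefficient (indifferenceGraph (d x)) (α x) ≢ 0

data Digit : Set where
  𝟏 𝟐 : Digit

data Letter : Set where
  step  : Step → Letter
  digit : Digit → Letter
  comma : Letter

-- Binary notation, most significant digit first, with the digits 1 and 2 in
-- place of 0 and 1, as in ℕᵇ (bijective base 2).  Every digit string denotes a
-- unique number (0 being the empty string), and the length is logarithmic.
digits : ℕᵇ → List Digit
digits zero     = []
digits 2[1+ m ] = digits m ∷ʳ 𝟐
digits 1+[2 m ] = digits m ∷ʳ 𝟏

-- The 2n letters of d, followed by the n entries of α, each preceded by a comma.
encode : Instance → List Letter
encode x =
  map step (steps (d x)) ++
  concatMap (λ a → comma ∷ map digit (digits (fromℕ a))) (toList (α x))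

NonvanishingLanguage : List Letter → Set
NonvanishingLanguage w = ∃[ x ] (encode x ≡ w × Nonvanishing x)

{-# OPTIONS --safe #-}

-- Scan d: an 𝗇 step creates a vertex, which needs a colour different from those
-- of the vertices not yet retired by an 𝖾 step; these are adjacent to each other
-- and are retired in order of creation, so their colours form a queue without
-- repetitions.  Only the number of vertices that each colour still has to receive
-- matters, and it is never wrong to take a free colour for which it is largest: if
-- a solution takes b where a has at least as many vertices left, exchange a and b
-- on the component of the new vertex in the subgraph of these two colours, which
-- is a disjoint union of paths, and, if that component has one b too many, also on
-- a later component with one a too many.  The greedy algorithm keeps these numbers
-- in unary on stacks, one per tape.  An encoded entry of α is converted to unary
-- against a budget of n for the total, and the input is rejected when the budget is
-- exceeded; so the running time is bounded in terms of n alone, however large the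
-- entries are.

module Submission where

open import Defs
open import Data.Bool.Base using (Bool; true; false; if_then_else_)
open import Data.Fin.Base using (Fin; zero; suc; toℕ)
open import Data.Fin.Patterns
import Data.Fin.Properties as Fin
open import Data.List.Base using (List; []; _∷_; _++_; _∷ʳ_; _ʳ++_; map;
  concatMap; length; take; drop; reverse; allFin)
import Data.List.Base as List
open import Data.List.Properties
  using (++-assoc; ++-identityʳ; ʳ++-defn; length-++; length-++-≤ˡ; length-map; length-filter;
         length-reverse; map-++; map-∘; map-id; map-tabulate; map-cong-local; concatMap-++;
         unfold-reverse; reverse-involutive; ∷-injective)
open import Data.List.Membership.Propositional using (_∈_)
open import Data.List.Membership.Propositional.Properties
  using (∈-∃++; ∈-filter⁺; ∈-cartesianProductWith⁺; ∈-allFin; ∈-++⁺ˡ; ∈-++⁺ʳ; ∈-++⁻; ∈-map⁺)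
open import Data.List.Relation.Binary.Permutation.Propositional
  using (_↭_; ↭-refl; ↭-sym; ↭-trans; prep; swap; ↭-reflexive; ↭⇒↭ₛ)
open import Data.List.Relation.Binary.Permutation.Propositional.Properties
  using (drop-∷; shift; ∈-resp-↭; All-resp-↭; ↭-map-inv; map⁺; ++⁺ʳ; ++⁺ˡ; ∷↭∷ʳ; ++↭ʳ++; ↭-reverse)
import Data.List.Relation.Binary.Permutation.Setoid.Properties as PermS
open import Data.List.Relation.Unary.All as All using (All; []; _∷_)
open import Data.List.Relation.Unary.All.Properties using (all-filter; map⁻; ++⁻ˡ; ++⁻ʳ)
import Data.List.Relation.Unary.AllPairs as AllPairs
open import Data.List.Relation.Unary.Any using (here; there)
open import Data.List.Relation.Unary.Unique.Propositional using (Unique)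
open import Data.List.Relation.Unary.Unique.Propositional.Properties using (allFin⁺; Unique[x∷xs]⇒x∉xs)
open import Data.Maybe.Base using (Maybe; just; nothing; maybe′)
open import Data.Maybe.Properties using (just-injective)
open import Data.Nat.Base
open import Data.Nat.Binary using (ℕᵇ; zero; 2[1+_]; 1+[2_]; fromℕ)
import Data.Nat.Binary as ℕᵇ
open import Data.Nat.Binary.Properties using (fromℕ-toℕ; toℕ-fromℕ)
open import Data.Nat.ListAction using (sum)
open import Data.Nat.ListAction.Properties using (sum-↭)
open import Data.Nat.Properties
open import Data.Nat.Tactic.RingSolver using (solve-∀)
open import Data.Product.Base using (Σ-syntax; ∃-syntax; _×_; _,_; proj₁; proj₂; map₁)
open import Data.Sum.Base using (_⊎_; inj₁; inj₂; map₂)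
open import Data.Sum.Function.Propositional using (_⊎-↔_)
open import Data.Unit.Base using (⊤; tt)
open import Data.Vec.Base as Vec
  using (Vec; []; _∷_; lookup; tabulate; count; toList; fromList; zipWith; replicate; _[_]≔_; _[_]%=_)
import Data.Vec.Properties as Vec
open import Function.Base using (_∘_; id)
open import Function.Bundles using (_↔_; _⇔_; mk↔ₛ′; mk⇔)
open import Function.Properties.Inverse using (↔-sym; ↔-trans)
open import Relation.Binary.PropositionalEquality hiding ([_])
open import Relation.Nullary using (¬_; contradiction; yes; no)

-- The exchange argument

-- The two-colour subgraph is a union of paths because the earlier neighbours of a vertex are
-- pairwise adjacent, and so are the later ones: at most one of each kind has the other colour. No
-- component is ever constructed. As long as one of the two colours is queued, only the other can be
-- taken, so a component is a stretch of the run that lasts until both colours are free, and the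
-- exchange is carried out step by step along it. If the exchange leaves a correction due when both
-- are free, the given solution has strictly more vertices left for one of the two colours. Since
-- every count ends at 0, a later component must contain one vertex more of that colour than of the
-- other, and exchanging there settles the account.

module _ where

  private variable
    p : List Step
    P P′ Q R F xs ys zs : List ℕ
    b c e e′ l l′ m r : ℕ

  -- Tells whether the entry that a step takes from the pool is a distinguished one.
  ∷-↭-∷ : ∀ {A : Set} {x y : A} {xs ys : List A} → x ∷ xs ↭ y ∷ ys →
          (x ≡ y × xs ↭ ys) ⊎ (∃[ zs ] (xs ↭ y ∷ zs × ys ↭ x ∷ zs))
  ∷-↭-∷ {x = x} {y} σ with ∈-resp-↭ (↭-sym σ) (here refl)
  ... | here refl = inj₁ (refl , drop-∷ σ)
  ... | there y∈xs with us , vs , refl ← ∈-∃++ y∈xs =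
    inj₂ (us ++ vs , shift y us vs
         , drop-∷ (↭-trans (↭-sym σ) (↭-trans (prep x (shift y us vs)) (swap x y ↭-refl))))

  -- A colour matters only through the number of vertices it still has to
  -- receive.  P lists these numbers for the free colours, in any order; F lists
  -- them for the colours of the vertices that are still adjacent to the next one,
  -- oldest vertex first: an 𝗇 step adds a vertex, the i-th 𝖾 step retires vertex i.
  data Feasible : List Step → List ℕ → List ℕ → Set where
    finish : All (_≡ 0) P → Feasible [] P []
    open𝗇  : P ↭ suc m ∷ Q → Feasible p Q (F ∷ʳ m) → Feasible (𝗇 ∷ p) P F
    close𝖾 : Feasible p (m ∷ P) F → Feasible (𝖾 ∷ p) P (m ∷ F)

  Feasible-resp-↭ : P ↭ P′ → Feasible p P F → Feasible p P′ F
  Feasible-resp-↭ σ (finish zs)  = finish (All-resp-↭ σ zs)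
  Feasible-resp-↭ σ (open𝗇 τ f)  = open𝗇 (↭-trans (↭-sym σ) τ) f
  Feasible-resp-↭ σ (close𝖾 f)   = close𝖾 (Feasible-resp-↭ (prep _ σ) f)

  -- Counts of two colours a and b: e for the one used longer ago and l for the
  -- one used last in a given solution, e′ and l′ for the colours used at the same
  -- vertices in the solution being built from it.  While crossed, a and b have
  -- exchanged their roles; while straight, the first solution has one vertex more
  -- left for the colour with the larger count, and one less for the other.
  data Shift : (e l e′ l′ : ℕ) → Set where
    crossed-larger   : b ≤ c → Shift (suc c) b (suc b) c
    crossed-smaller  : b ≤ c → Shift b c c b
    straight-larger  : b < c → Shift (suc c) b c (suc b)
    straight-smaller : b ≤ c → Shift b (suc c) (suc b) c

  -- The colour taken becomes the one used last, so each pair is reversed. The inequalities in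
  -- `Shift` guarantee that the solution being built can follow: in `straight-larger`, strictness
  -- makes `e′` positive.
  Shift-use : Shift (suc e) l e′ l′ → ∃[ e″ ] (e′ ≡ suc e″ × Shift l e l′ e″)
  Shift-use (crossed-larger b≤c)        = _ , refl , crossed-smaller b≤c
  Shift-use (crossed-smaller (s≤s b≤c)) = _ , refl , crossed-larger b≤c
  Shift-use (straight-larger (s≤s b≤c)) = _ , refl , straight-smaller b≤c
  Shift-use (straight-smaller b<c)      = _ , refl , straight-larger b<c

  -- Once both colours are free only the multiset of counts matters. It is already the desired one,
  -- or it is too uneven by one unit, which `exchange-free` repairs.
  Shift-free : Shift e l e′ l′ → (e ∷ l ∷ R ↭ e′ ∷ l′ ∷ R) ⊎
    (∃[ b ] ∃[ c ] (b ≤ c × (e ∷ l ∷ R ↭ suc c ∷ b ∷ R) × (c ∷ suc b ∷ R ↭ e′ ∷ l′ ∷ R)))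
  Shift-free (crossed-larger b≤c)   = inj₂ (_ , _ , b≤c , ↭-refl , swap _ _ ↭-refl)
  Shift-free (crossed-smaller _)    = inj₁ (swap _ _ ↭-refl)
  Shift-free (straight-larger b<c)  = inj₂ (_ , _ , <⇒≤ b<c , ↭-refl , ↭-refl)
  Shift-free (straight-smaller b≤c) = inj₂ (_ , _ , b≤c , swap _ _ ↭-refl , swap _ _ ↭-refl)

  private
    ∷ʳ-inside : ∀ (xs : List ℕ) {l ys m} → (xs ++ l ∷ ys) ∷ʳ m ≡ xs ++ l ∷ ys ∷ʳ m
    ∷ʳ-inside xs = ++-assoc xs _ _

    ∷ʳ-inside₂ : ∀ (xs : List ℕ) {e ys l zs m} →
                 (xs ++ e ∷ ys ++ l ∷ zs) ∷ʳ m ≡ xs ++ e ∷ ys ++ l ∷ zs ∷ʳ m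
    ∷ʳ-inside₂ xs {e} {ys} = trans (∷ʳ-inside xs) (cong (λ u → xs ++ e ∷ u) (∷ʳ-inside ys))

  swap-up : ∀ {x y : ℕ} {xs ys} → xs ↭ y ∷ ys → x ∷ xs ↭ y ∷ x ∷ ys
  swap-up σ = ↭-trans (prep _ σ) (swap _ _ ↭-refl)

  -- Three mutual inductions on the path, according to whether both colours, one or none are queued.
  -- Steps that concern other colours are copied; the colour used longer ago stands further ahead in
  -- the queue and is retired first.
  exchange-queued : ∀ p zs xs → Shift e l e′ l′ →
    Feasible p P (zs ++ e ∷ xs ++ l ∷ ys) → Feasible p P (zs ++ e′ ∷ xs ++ l′ ∷ ys)
  exchange-half : ∀ p xs → Shift e l e′ l′ →
    Feasible p (e ∷ R) (xs ++ l ∷ ys) → Feasible p (e′ ∷ R) (xs ++ l′ ∷ ys)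
  -- Making two counts more even never hurts. A component that begins with the larger colour is
  -- exchanged; one that begins with the smaller is kept, since exchanging it could not reduce the
  -- surplus of the larger.
  exchange-free : ∀ p → b ≤ c →
    Feasible p (suc c ∷ b ∷ R) F → Feasible p (c ∷ suc b ∷ R) F

  exchange-queued [] []       xs s ()
  exchange-queued [] (_ ∷ _)  xs s ()
  exchange-queued (𝗇 ∷ p) zs xs s (open𝗇 σ f) =
    open𝗇 σ (subst (Feasible p _) (sym (∷ʳ-inside₂ zs))
              (exchange-queued p zs xs s (subst (Feasible p _) (∷ʳ-inside₂ zs) f)))
  exchange-queued (𝖾 ∷ p) []       xs s (close𝖾 f) = close𝖾 (exchange-half p xs s f)
  exchange-queued (𝖾 ∷ p) (_ ∷ zs) xs s (close𝖾 f) = close𝖾 (exchange-queued p zs xs s f)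

  exchange-half [] []      s ()
  exchange-half [] (_ ∷ _) s ()
  exchange-half (𝗇 ∷ p) xs s (open𝗇 σ f) with ∷-↭-∷ σ
  ... | inj₁ (refl , R↭Q) with _ , refl , s′ ← Shift-use s =
    open𝗇 ↭-refl (subst (Feasible p _) (sym (∷ʳ-inside xs))
      (exchange-queued p xs _ s′
        (Feasible-resp-↭ (↭-sym R↭Q) (subst (Feasible p _) (∷ʳ-inside xs) f))))
  ... | inj₂ (R′ , R↭ , Q↭) =
    open𝗇 (swap-up R↭) (subst (Feasible p _) (sym (∷ʳ-inside xs))
      (exchange-half p xs s
        (Feasible-resp-↭ Q↭ (subst (Feasible p _) (∷ʳ-inside xs) f))))
  exchange-half {R = R} (𝖾 ∷ p) [] s (close𝖾 f) with Shift-free {R = R} s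
  ... | inj₁ σ = close𝖾 (Feasible-resp-↭ (↭-trans (swap _ _ ↭-refl) (↭-trans σ (swap _ _ ↭-refl))) f)
  ... | inj₂ (b , c , b≤c , σ , τ) =
    close𝖾 (Feasible-resp-↭ (↭-trans τ (swap _ _ ↭-refl))
      (exchange-free p b≤c (Feasible-resp-↭ (↭-trans (swap _ _ ↭-refl) σ) f)))
  exchange-half (𝖾 ∷ p) (x ∷ xs) s (close𝖾 f) =
    close𝖾 (Feasible-resp-↭ (swap _ _ ↭-refl)
      (exchange-half p xs s (Feasible-resp-↭ (swap _ _ ↭-refl) f)))

  -- The correction cannot remain due to the end: `suc c` vertices would be left over.
  exchange-free [] b≤c (finish (() ∷ _))
  exchange-free (𝗇 ∷ p) b≤c (open𝗇 σ f) with ∷-↭-∷ σ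
  ... | inj₁ (refl , bR↭Q) =
    open𝗇 (swap _ _ ↭-refl) (exchange-half p _ (crossed-smaller b≤c) (Feasible-resp-↭ (↭-sym bR↭Q) f))
  ... | inj₂ (_ , bR↭ , Q↭) with ∷-↭-∷ bR↭
  ...   | inj₁ (refl , R↭) =
    open𝗇 (swap _ _ ↭-refl) (exchange-half p _ (straight-larger b≤c)
      (Feasible-resp-↭ (↭-trans Q↭ (prep _ (↭-sym R↭))) f))
  ...   | inj₂ (_ , R↭ , Q′↭) =
    open𝗇 (swap-up (swap-up R↭)) (exchange-free p b≤c (Feasible-resp-↭ (↭-trans Q↭ (prep _ Q′↭)) f))
  exchange-free (𝖾 ∷ p) b≤c (close𝖾 f) =
    close𝖾 (Feasible-resp-↭ (swap-up (swap-up ↭-refl))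
      (exchange-free p b≤c (Feasible-resp-↭ (↭-sym (swap-up (swap-up ↭-refl))) f)))

  -- If the solution takes another entry `suc b`, maximality gives `m ≡ suc k` with `b ≤ k`, and the
  -- two colours are crossed from this vertex on.
  largest-first : Feasible (𝗇 ∷ p) P F → P ↭ m ∷ Q → All (_≤ m) P →
                  ∃[ k ] (m ≡ suc k × Feasible p Q (F ∷ʳ k))
  largest-first {p} {F = F} (open𝗇 σ f) τ P≤m with ∷-↭-∷ (↭-trans (↭-sym τ) σ)
  ... | inj₁ (refl , Q↭) = _ , refl , Feasible-resp-↭ (↭-sym Q↭) f
  ... | inj₂ (R , Q↭ , Q′↭) with s≤s b≤k ∷ _ ← All-resp-↭ σ P≤m =
    _ , refl , Feasible-resp-↭ (↭-sym Q↭)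
      (exchange-half p F (crossed-larger b≤k) (Feasible-resp-↭ Q′↭ f))

  -- r + (m ∸ r) is the maximum of m and r, in the form in which the program
  -- below computes it.
  extract : ℕ → List ℕ → List ℕ → ℕ × List ℕ
  extract m Q []      = m , Q
  extract m Q (r ∷ P) = extract (r + (m ∸ r)) (m ⊓ r ∷ Q) P

  max∷min↭ : ∀ m r → r + (m ∸ r) ∷ m ⊓ r ∷ Q ↭ m ∷ r ∷ Q
  max∷min↭ m r with ≤-total m r
  ... | inj₁ m≤r rewrite m≤n⇒m∸n≡0 m≤r | m≤n⇒m⊓n≡m m≤r | +-identityʳ r = swap _ _ ↭-refl
  ... | inj₂ r≤m rewrite m+[n∸m]≡n r≤m | m≥n⇒m⊓n≡n r≤m = ↭-refl

  extract-↭ : ∀ m Q P → let k , R = extract m Q P in k ∷ R ↭ m ∷ Q ++ P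
  extract-↭ m Q []      = ↭-reflexive (cong (m ∷_) (sym (++-identityʳ Q)))
  extract-↭ m Q (r ∷ P) = ↭-trans (extract-↭ _ _ P)
    (↭-trans (max∷min↭ m r) (prep m (↭-sym (shift r Q P))))

  extract-max : ∀ m Q P → All (_≤ m) Q → let k , R = extract m Q P in All (_≤ k) R
  extract-max m Q []      Q≤m = Q≤m
  extract-max m Q (r ∷ P) Q≤m = extract-max _ _ P
    (≤-trans (m⊓n≤m m r) m≤ ∷ All.map (λ x≤m → ≤-trans x≤m m≤) Q≤m)
    where m≤ = m≤n+m∸n m r

  -- The greedy algorithm on lists of counts

  exhausted : List ℕ → Verdict
  exhausted []          = accept
  exhausted (zero ∷ P)  = exhausted P
  exhausted (suc _ ∷ P) = reject

  greedy : List Step → List ℕ → List ℕ → Verdict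
  serve  : List Step → List ℕ → ℕ × List ℕ → Verdict

  greedy []      P       []      = exhausted P
  greedy []      P       (_ ∷ _) = reject
  greedy (𝗇 ∷ p) []      F       = reject
  greedy (𝗇 ∷ p) (r ∷ P) F       = serve p F (extract r [] P)
  greedy (𝖾 ∷ p) P       []      = reject
  greedy (𝖾 ∷ p) P       (m ∷ F) = greedy p (m ∷ P) F

  serve p F (zero  , Q) = reject
  serve p F (suc m , Q) = greedy p (Q ʳ++ []) (F ∷ʳ m)

  ʳ++[]-↭ : ∀ (Q : List ℕ) → Q ʳ++ [] ↭ Q
  ʳ++[]-↭ Q = ↭-sym (↭-trans (↭-reflexive (sym (++-identityʳ Q))) (++↭ʳ++ Q []))

  exhausted⁻ : ∀ P → exhausted P ≡ accept → All (_≡ 0) P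
  exhausted⁻ []         _  = []
  exhausted⁻ (zero ∷ P) eq = refl ∷ exhausted⁻ P eq

  exhausted⁺ : All (_≡ 0) P → exhausted P ≡ accept
  exhausted⁺ []          = refl
  exhausted⁺ (refl ∷ zs) = exhausted⁺ zs

  greedy-sound : ∀ p P F → greedy p P F ≡ accept → Feasible p P F
  greedy-sound []      P       []      eq = finish (exhausted⁻ P eq)
  greedy-sound (𝗇 ∷ p) (r ∷ P) F       eq
    with extract r [] P | extract-↭ r [] P
  ... | suc m , Q | σ = open𝗇 (↭-sym σ) (Feasible-resp-↭ (ʳ++[]-↭ Q) (greedy-sound p _ _ eq))
  greedy-sound (𝖾 ∷ p) P       (m ∷ F) eq = close𝖾 (greedy-sound p (m ∷ P) F eq)

  greedy-complete : Feasible p P F → greedy p P F ≡ accept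
  greedy-complete f = go _ f
    where
    go : ∀ p → Feasible p P F → greedy p P F ≡ accept
    go [] (finish zs) = exhausted⁺ zs
    go {P = []} (𝗇 ∷ p) (open𝗇 σ f) with () ← ∈-resp-↭ (↭-sym σ) (here refl)
    go {P = r ∷ P} (𝗇 ∷ p) f
      with k , Q ← extract r [] P | σ ← extract-↭ r [] P | Q≤k ← extract-max r [] P []
      with m , refl , g ← largest-first f (↭-sym σ) (All-resp-↭ σ (≤-refl ∷ Q≤k)) =
      go p (Feasible-resp-↭ (↭-sym (ʳ++[]-↭ Q)) g)
    go (𝖾 ∷ p) (close𝖾 f) = go p f

-- Colourings as runs

length-∷ʳ-+ : ∀ {A : Set} (F : List A) c h → length (F ∷ʳ c) + h ≡ length F + suc h
length-∷ʳ-+ F c h = trans (cong (_+ h) (length-++ F)) (+-assoc (length F) 1 h)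

-- A relation rather than a lookup function, so that positions out of range satisfy nothing and need
-- no default.
data At {A : Set} : List A → ℕ → A → Set where
  here  : ∀ {x xs} → At (x ∷ xs) 0 x
  there : ∀ {x y xs i} → At xs i x → At (y ∷ xs) (suc i) x

∈⇒At : ∀ {A : Set} {x : A} {xs} → x ∈ xs → ∃[ i ] (i < length xs × ∀ {ys} → At (xs ++ ys) i x)
∈⇒At (here refl) = 0 , z<s , here
∈⇒At (there x∈)  with i , i< , at ← ∈⇒At x∈ = suc i , s<s i< , there at

At⇒∈ : ∀ {A : Set} {x : A} xs {ys i} → i < length xs → At (xs ++ ys) i x → x ∈ xs
At⇒∈ (x ∷ xs) i<       here       = here refl
At⇒∈ (x ∷ xs) (s<s i<) (there at) = there (At⇒∈ xs i< at)

At-middle : ∀ {A : Set} {x : A} xs {ys} → At (xs ++ x ∷ ys) (length xs) x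
At-middle []       = here
At-middle (_ ∷ xs) = there (At-middle xs)

At-[] : ∀ {A : Set} {i} {x : A} → ¬ At [] i x
At-[] ()

module _ {A : Set} where

  private variable
    p : List Step
    P Q F ws : List A
    c : A

  -- The colours of the vertices still to be read are ws; those of the
  -- unfinished ones are F, and P holds the colours not in F.
  data Schedule : List Step → List A → List A → List A → Set where
    finish : Schedule [] P [] []
    open𝗇  : P ↭ c ∷ Q → Schedule p Q (F ∷ʳ c) ws → Schedule (𝗇 ∷ p) P F (c ∷ ws)
    close𝖾 : Schedule p (c ∷ P) F ws → Schedule (𝖾 ∷ p) P (c ∷ F) ws

  -- Positions in `F ++ ws` number the vertices from the oldest unfinished one on; `length F`
  -- accounts for the vertices created before `p` begins. For empty `F` this is properness for the
  -- indifference graph.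
  ProperFrom : List Step → List A → List A → Set
  ProperFrom p F ws = ∀ i j → i < j → j < length F + hessenberg p i →
                      ∀ {c} → At (F ++ ws) i c → ¬ At (F ++ ws) j c

  Unique-resp-↭ : P ↭ Q → Unique P → Unique Q
  Unique-resp-↭ σ = PermS.Unique-resp-↭ (setoid A) (↭⇒↭ₛ σ)

  open𝗇-↭ : ∀ {c : A} P F → P ++ F ∷ʳ c ↭ c ∷ P ++ F
  open𝗇-↭ {c} P F = ↭-trans (++⁺ˡ P (↭-sym (∷↭∷ʳ c F))) (shift c P F)

  open𝗇-reorder : P ↭ c ∷ Q → P ++ F ↭ Q ++ F ∷ʳ c
  open𝗇-reorder {Q = Q} {F} σ = ↭-trans (++⁺ʳ F σ) (↭-sym (open𝗇-↭ Q F))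

  close𝖾-reorder : ∀ (P : List A) {c F} → P ++ c ∷ F ↭ (c ∷ P) ++ F
  close𝖾-reorder P {c} {F} = shift c P F

  ProperFrom-𝗇 : ∀ p F → ProperFrom (𝗇 ∷ p) F (c ∷ ws) → ProperFrom p (F ∷ʳ c) ws
  ProperFrom-𝗇 {c} {ws} p F pf i j i<j j<
    rewrite length-∷ʳ-+ F c (hessenberg p i) | ++-assoc F (c ∷ []) ws = pf i j i<j j<

  ProperFrom-𝗇⁻ : ∀ p F → ProperFrom p (F ∷ʳ c) ws → ProperFrom (𝗇 ∷ p) F (c ∷ ws)
  ProperFrom-𝗇⁻ {c} {ws} p F pf i j i<j j< {x} at at′ =
    pf i j i<j (subst (j <_) (sym (length-∷ʳ-+ F c (hessenberg p i))) j<)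
      (subst (λ u → At u i x) eq at) (subst (λ u → At u j x) eq at′)
    where eq = sym (++-assoc F (c ∷ []) ws)

  schedule⇒proper : Schedule p P F ws → Unique (P ++ F) → ProperFrom p F ws
  schedule⇒proper finish _ i j _ _ at _ = At-[] at
  schedule⇒proper (open𝗇 {p = p} {F} σ s) u =
    ProperFrom-𝗇⁻ p F (schedule⇒proper s (Unique-resp-↭ (open𝗇-reorder σ) u))
  -- The oldest vertex retires here, so its later neighbours are exactly the other vertices in the
  -- queue.
  schedule⇒proper (close𝖾 {P = P} {F} s) u zero (suc j) _ (s<s j<) here (there at) =
    Unique[x∷xs]⇒x∉xs (Unique-resp-↭ (close𝖾-reorder P) u)
      (∈-++⁺ʳ P (At⇒∈ F (subst (j <_) (+-identityʳ _) j<) at))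
  schedule⇒proper (close𝖾 {P = P} s) u (suc i) (suc j) (s<s i<j) (s<s j<) (there at) (there at′) =
    schedule⇒proper s (Unique-resp-↭ (close𝖾-reorder P) u) i j i<j j< at at′

  -- A new vertex is adjacent to every unfinished one, so properness forces its colour to come from
  -- `P`. The prefix inequality keeps the queue nonempty at each 𝖾, and the equation for the totals
  -- makes it empty at the end.
  proper⇒schedule : ∀ p {P F ws : List A} → length ws ≡ #[ 𝗇 ] p → #[ 𝖾 ] p ≡ length F + #[ 𝗇 ] p →
    (∀ k → #[ 𝖾 ] (take k p) ≤ length F + #[ 𝗇 ] (take k p)) →
    All (_∈ P ++ F) ws → ProperFrom p F ws → Schedule p P F ws
  proper⇒schedule [] {F = []} {[]} _ _ _ _ _ = finish
  proper⇒schedule (𝗇 ∷ p) {P} {F} {c ∷ ws} lw e dyck (c∈ ∷ ws∈) pf with ∈-++⁻ P c∈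
  ... | inj₂ c∈F with i , i< , at ← ∈⇒At c∈F =
    contradiction (At-middle F)
      (pf i (length F) i< (subst (length F <_) (sym (+-suc _ _)) (s≤s (m≤m+n _ _))) at)
  ... | inj₁ c∈P with xs , ys , refl ← ∈-∃++ c∈P =
    open𝗇 (shift c xs ys) (proper⇒schedule p (suc-injective lw)
      (trans e (sym (length-∷ʳ-+ F c (#[ 𝗇 ] p))))
      (λ k → subst (#[ 𝖾 ] (take k p) ≤_) (sym (length-∷ʳ-+ F c _)) (dyck (suc k)))
      (All.map (∈-resp-↭ (open𝗇-reorder (shift c xs ys))) ws∈)
      (ProperFrom-𝗇 p F pf))
  proper⇒schedule (𝖾 ∷ p) {P} {[]} _ _ dyck _ _ with () ← dyck 1
  proper⇒schedule (𝖾 ∷ p) {P} {c ∷ F} lw e dyck ws∈ pf =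
    close𝖾 (proper⇒schedule p lw (suc-injective e) (λ k → s≤s⁻¹ (dyck (suc k)))
      (All.map (∈-resp-↭ (close𝖾-reorder P)) ws∈)
      (λ i j i<j j< at at′ → pf (suc i) (suc j) (s<s i<j) (s<s j<) (there at) (there at′)))

  schedule-norths : Schedule p P F ws → length ws ≡ #[ 𝗇 ] p
  schedule-norths finish       = refl
  schedule-norths (open𝗇 _ s)  = cong suc (schedule-norths s)
  schedule-norths (close𝖾 s)   = schedule-norths s

-- With `feasible-diagonal`, this shows that a word on which the greedy algorithm succeeds is a Dyck
-- path; the program has no separate test for that.
feasible-easts : ∀ {p P F} → Feasible p P F → #[ 𝖾 ] p ≡ length F + #[ 𝗇 ] p
feasible-easts (finish _)            = refl
feasible-easts (open𝗇 {F = F} σ f)   = trans (feasible-easts f) (length-∷ʳ-+ F _ _)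
feasible-easts (close𝖾 f)            = cong suc (feasible-easts f)

feasible-diagonal : ∀ {p P F} → Feasible p P F → ∀ k → #[ 𝖾 ] (take k p) ≤ length F + #[ 𝗇 ] (take k p)
feasible-diagonal f                   zero    = z≤n
feasible-diagonal (finish _)          (suc k) = z≤n
feasible-diagonal (open𝗇 {p = p} {F} σ f) (suc k) =
  subst (#[ 𝖾 ] (take k p) ≤_) (length-∷ʳ-+ F _ _) (feasible-diagonal f k)
feasible-diagonal (close𝖾 f)          (suc k) = s≤s (feasible-diagonal f k)

sum-zeros : ∀ {P} → All (_≡ 0) P → sum P ≡ 0
sum-zeros []          = refl
sum-zeros (refl ∷ zs) = sum-zeros zs

-- Each 𝗇 consumes one unit. This justifies the number of 𝗇 steps as the budget for the entries of
-- the weight.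
feasible-sum : ∀ {p P F} → Feasible p P F → sum (P ++ F) ≡ #[ 𝗇 ] p
feasible-sum (finish {P} zs) = trans (cong sum (++-identityʳ P)) (sum-zeros zs)
feasible-sum (open𝗇 {Q = Q} {F = F} σ f) =
  trans (sum-↭ (++⁺ʳ F σ)) (cong suc (trans (sym (sum-↭ (open𝗇-↭ Q F))) (feasible-sum f)))
feasible-sum (close𝖾 {P = P} f) = trans (sum-↭ (close𝖾-reorder P)) (feasible-sum f)

module _ {k : ℕ} where

  multiplicity : List (Fin k) → Fin k → ℕ
  multiplicity ws c = count (c Fin.≟_) (fromList ws)

  multiplicity-same : ∀ c ws → multiplicity (c ∷ ws) c ≡ suc (multiplicity ws c)
  multiplicity-same c ws with c Fin.≟ c
  ... | yes _ = refl
  ... | no ¬r = contradiction refl ¬r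

  multiplicity-other : ∀ {c c′} ws → c ≢ c′ → multiplicity (c ∷ ws) c′ ≡ multiplicity ws c′
  multiplicity-other {c} {c′} ws c≢c′ with c′ Fin.≟ c
  ... | yes r = contradiction (sym r) c≢c′
  ... | no  _ = refl

  count-multiplicity : ∀ {n} c (f : Vec (Fin k) n) → count (c Fin.≟_) f ≡ multiplicity (toList f) c
  count-multiplicity c []      = refl
  count-multiplicity c (x ∷ f) with c Fin.≟ x
  ... | yes _ = cong suc (count-multiplicity c f)
  ... | no  _ = count-multiplicity c f

  map-multiplicity : ∀ {c xs} ws → All (c ≢_) xs → map (multiplicity (c ∷ ws)) xs ≡ map (multiplicity ws) xs
  map-multiplicity ws c∉ = map-cong-local (All.map (multiplicity-other ws) c∉)

  -- The count of a colour is its multiplicity among the vertices still to be read; taking `c`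
  -- changes no other count because `c` does not occur in `Q ++ F`.
  schedule⇒feasible : ∀ {p P F ws} → Schedule p P F ws → Unique (P ++ F) →
                      Feasible p (map (multiplicity ws) P) (map (multiplicity ws) F)
  schedule⇒feasible (finish {P}) u = finish (zeros P)
    where
    zeros : ∀ P → All (_≡ 0) (map (multiplicity []) P)
    zeros []      = []
    zeros (_ ∷ P) = refl ∷ zeros P
  schedule⇒feasible (open𝗇 {P} {c} {Q} {F = F} {ws} σ s) u =
    open𝗇 (↭-trans (map⁺ _ σ) (↭-reflexive (cong₂ _∷_ (multiplicity-same c ws) (map-multiplicity ws (++⁻ˡ Q c∉)))))
      (subst (Feasible _ _) (trans (map-++ _ F (c ∷ [])) (cong (_∷ʳ _) (sym (map-multiplicity ws (++⁻ʳ Q c∉)))))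
        (schedule⇒feasible s (Unique-resp-↭ (open𝗇-reorder σ) u)))
    where
    c∉ : All (c ≢_) (Q ++ F)
    c∉ = AllPairs.head (Unique-resp-↭ (++⁺ʳ F σ) u)
  schedule⇒feasible (close𝖾 {P = P} s) u = close𝖾 (schedule⇒feasible s (Unique-resp-↭ (close𝖾-reorder P) u))

  Realises : List (Fin k) → Fin k × ℕ → Set
  Realises ws (c , m) = multiplicity ws c ≡ m

  -- `Feasible` has forgotten the colours, so they are carried along as labels: `↭-map-inv` lifts a
  -- permutation of the counts to one of the labelled counts.
  feasible⇒schedule : ∀ p (Z Y : List (Fin k × ℕ)) → Feasible p (map proj₂ Z) (map proj₂ Y) →
    Unique (map proj₁ (Z ++ Y)) →
    ∃[ ws ] (Schedule p (map proj₁ Z) (map proj₁ Y) ws × All (Realises ws) (Z ++ Y))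
  feasible⇒schedule [] Z [] (finish zs) u = [] , finish , zero-counts Z zs
    where
    zero-counts : ∀ Z → All (_≡ 0) (map proj₂ Z) → All (Realises []) (Z ++ [])
    zero-counts []      []        = []
    zero-counts (_ ∷ Z) (eq ∷ zs) = sym eq ∷ zero-counts Z zs
  feasible⇒schedule (𝗇 ∷ p) Z Y (open𝗇 {m = m} σ f) u
    with ↭-map-inv proj₂ σ
  ... | (c , _) ∷ Z′ , eq , τ with refl , refl ← ∷-injective eq
    with ws , s , rs ← feasible⇒schedule p Z′ (Y ∷ʳ (c , m))
           (subst (Feasible p _) (sym (map-++ proj₂ Y _)) f)
           (Unique-resp-↭ (↭-trans (map⁺ proj₁ (++⁺ʳ Y τ)) (map⁺ proj₁ (↭-sym (open𝗇-↭ Z′ Y)))) u)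
    with r ∷ rs′ ← All-resp-↭ (open𝗇-↭ Z′ Y) rs
    with c∉ ← AllPairs.head (Unique-resp-↭ (map⁺ proj₁ (++⁺ʳ Y τ)) u) =
    c ∷ ws
    , open𝗇 (map⁺ proj₁ τ) (subst (λ F → Schedule p _ F ws) (map-++ proj₁ Y _) s)
    , All-resp-↭ (↭-sym (++⁺ʳ Y τ))
        (trans (multiplicity-same c ws) (cong suc r)
        ∷ All.zipWith (λ (c≢ , r′) → trans (multiplicity-other ws c≢) r′) (map⁻ c∉ , rs′))
  feasible⇒schedule (𝖾 ∷ p) Z (y ∷ Y) (close𝖾 f) u
    with ws , s , rs ← feasible⇒schedule p (y ∷ Z) Y f (Unique-resp-↭ (map⁺ proj₁ (close𝖾-reorder Z)) u)
    = ws , close𝖾 s , All-resp-↭ (↭-sym (close𝖾-reorder Z)) rs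

coefficient≢0⁺ : ∀ {n k} (G : Graph n) {α : Vec ℕ k} f → Proper G f → weight f ≡ α → coefficient G α ≢ 0
coefficient≢0⁺ {n} {k} G f pf refl eq =
  ≢[] (∈-filter⁺ _ (∈-allColorings f) (pf , refl)) (length≡0 eq)
  where
  ∈-allColorings : ∀ {n} (f : Coloring n k) → f ∈ allColorings n k
  ∈-allColorings []      = here refl
  ∈-allColorings (c ∷ f) = ∈-cartesianProductWith⁺ _∷_ (∈-allFin c) (∈-allColorings f)
  ≢[] : ∀ {xs} → f ∈ xs → xs ≢ []
  ≢[] (here _)  ()
  ≢[] (there _) ()
  length≡0 : ∀ {xs : List (Coloring n k)} → length xs ≡ 0 → xs ≡ []
  length≡0 {[]} _ = refl

coefficient≢0⁻ : ∀ {n k} (G : Graph n) (α : Vec ℕ k) → coefficient G α ≢ 0 →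
                 ∃[ f ] (Proper G f × weight f ≡ α)
coefficient≢0⁻ {n} {k} G α ≢0 = first (all-filter _ (allColorings n k)) ≢0
  where
  first : ∀ {P : Coloring n k → Set} {xs} → All P xs → length xs ≢ 0 → ∃[ f ] P f
  first []       ≢0 = contradiction refl ≢0
  first (px ∷ _) _  = _ , px

At-lookup : ∀ {A : Set} {n} (f : Vec A n) v → At (toList f) (toℕ v) (lookup f v)
At-lookup (_ ∷ f) zero    = here
At-lookup (_ ∷ f) (suc v) = there (At-lookup f v)

At-lookup⁻ : ∀ {A : Set} {n} (f : Vec A n) {i x} → At (toList f) i x → ∃[ v ] (toℕ v ≡ i × lookup f v ≡ x)
At-lookup⁻ (_ ∷ f) here       = zero , refl , refl
At-lookup⁻ (_ ∷ f) (there at) with v , refl , eq ← At-lookup⁻ f at = suc v , refl , eq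

module _ {n k : ℕ} (d : DyckPath n) (f : Coloring n k) where

  proper⇒properFrom : Proper (indifferenceGraph d) f → ProperFrom (steps d) [] (toList f)
  proper⇒properFrom pf i j i<j j< at at′
    with u , refl , eq ← At-lookup⁻ f at | v , refl , eq′ ← At-lookup⁻ f at′ =
    pf u v (inj₁ (i<j , j<)) (trans eq (sym eq′))

  properFrom⇒proper : ProperFrom (steps d) [] (toList f) → Proper (indifferenceGraph d) f
  properFrom⇒proper pf u v (inj₁ (u<v , v<)) eq =
    pf (toℕ u) (toℕ v) u<v v< (At-lookup f u) (subst (At _ _) (sym eq) (At-lookup f v))
  properFrom⇒proper pf u v (inj₂ (v<u , u<)) eq =
    pf (toℕ v) (toℕ u) v<u u< (At-lookup f v) (subst (At _ _) eq (At-lookup f u))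

toList-tabulate : ∀ {A : Set} {k} (g : Fin k → A) → toList (tabulate g) ≡ map g (allFin k)
toList-tabulate {k = zero}  g = refl
toList-tabulate {k = suc k} g = cong (g zero ∷_) (trans (toList-tabulate (g ∘ suc))
  (trans (map-tabulate id (g ∘ suc)) (sym (map-tabulate suc g))))

weight-multiplicity : ∀ {n k} (f : Coloring n k) → weight f ≡ tabulate (multiplicity (toList f))
weight-multiplicity f = Vec.tabulate-cong (λ c → count-multiplicity c f)

nonvanishing⇒feasible : ∀ {n} (d : DyckPath n) (α : Vec ℕ n) →
  coefficient (indifferenceGraph d) α ≢ 0 → Feasible (steps d) (toList α) []
nonvanishing⇒feasible {n} d α ≢0 with f , pf , refl ← coefficient≢0⁻ (indifferenceGraph d) α ≢0 =
  subst (λ P → Feasible (steps d) P [])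
    (sym (trans (cong toList (weight-multiplicity f)) (toList-tabulate (multiplicity (toList f)))))
    (schedule⇒feasible
      (proper⇒schedule (steps d) (trans (Vec.length-toList f) (sym (norths d))) (trans (easts d) (sym (norths d)))
        (diagonal d) (All.universal (λ c → ∈-++⁺ˡ (∈-allFin c)) _) (proper⇒properFrom d f pf))
      (subst Unique (sym (++-identityʳ _)) (allFin⁺ n)))

fromList′ : ∀ {A : Set} {n} (ws : List A) → length ws ≡ n → ∃[ f ] (toList {n = n} f ≡ ws)
fromList′ ws refl = fromList ws , Vec.toList∘fromList ws

private
  labels : ∀ n {α : Fin n → ℕ} → map proj₁ (map (λ c → c , α c) (allFin n)) ≡ allFin n
  labels n = trans (sym (map-∘ (allFin n))) (map-id (allFin n))

feasible⇒nonvanishing : ∀ {n} (d : DyckPath n) (α : Vec ℕ n) →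
  Feasible (steps d) (toList α) [] → coefficient (indifferenceGraph d) α ≢ 0
feasible⇒nonvanishing {n} d α fs
  with ws , s , rs ← feasible⇒schedule (steps d) (map (λ c → c , lookup α c) (allFin n)) []
         (subst (λ P → Feasible (steps d) P [])
           (trans (cong toList (sym (Vec.tabulate∘lookup α)))
             (trans (toList-tabulate (lookup α)) (map-∘ (allFin n)))) fs)
         (subst Unique (sym (trans (cong (map proj₁) (++-identityʳ _)) (labels n))) (allFin⁺ n))
  with f , refl ← fromList′ ws (trans (schedule-norths s) (norths d)) =
  coefficient≢0⁺ (indifferenceGraph d) f
    (properFrom⇒proper d f (schedule⇒proper s (subst Unique (sym (trans (++-identityʳ _) (labels n))) (allFin⁺ n))))
    (trans (weight-multiplicity f)
      (trans (Vec.tabulate-cong (λ c → All.lookup rs (∈-++⁺ˡ (∈-map⁺ _ (∈-allFin c))))) (Vec.tabulate∘lookup α)))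

-- Decoding the weight

value : Digit → ℕ
value 𝟏 = 1
value 𝟐 = 2

entries : List ℕ → List Letter
entries = concatMap (λ a → comma ∷ map digit (digits (fromℕ a)))

-- P lists the entries read so far, last one first, c is the number of entries
-- still to come, and b is what remains of their total.
read : List Letter → ℕ → ℕ → List ℕ → Maybe (List ℕ)
read []            zero    zero    P       = just P
read []            zero    (suc b) P       = nothing
read []            (suc c) b       P       = nothing
read (comma ∷ w)   (suc c) b       P       = read w c b (0 ∷ P)
read (comma ∷ w)   zero    b       P       = nothing
read (digit d ∷ w) c       b       (v ∷ P) with v + value d ≤? b
... | yes _ = read w c (b ∸ (v + value d)) (v + (v + value d) ∷ P)
... | no  _ = nothing
read (digit d ∷ w) c       b       []      = nothing
read (step s ∷ w)  c       b       P       = nothing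

private
  double+1 : ∀ x → x + (x + 1) ≡ suc (2 * x)
  double+1 = solve-∀

  double+2 : ∀ x → x + (x + 2) ≡ 2 * suc x
  double+2 = solve-∀

-- Appending a digit is Horner's rule. In bijective base 2 it always yields the notation of a
-- number, so no digit string has to be rejected as non-canonical.
digits-∷ʳ : ∀ v d → digits (fromℕ v) ∷ʳ d ≡ digits (fromℕ (v + (v + value d)))
digits-∷ʳ v d = trans (digits-append d)
  (cong digits (sym (trans (cong fromℕ (toℕ-append d)) (fromℕ-toℕ (append d)))))
  where
  append : Digit → ℕᵇ
  append 𝟏 = 1+[2 fromℕ v ]
  append 𝟐 = 2[1+ fromℕ v ]
  digits-append : ∀ d → digits (fromℕ v) ∷ʳ d ≡ digits (append d)
  digits-append 𝟏 = refl
  digits-append 𝟐 = refl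
  toℕ-append : ∀ d → v + (v + value d) ≡ ℕᵇ.toℕ (append d)
  toℕ-append 𝟏 = trans (double+1 v) (cong (λ x → suc (2 * x)) (sym (toℕ-fromℕ v)))
  toℕ-append 𝟐 = trans (double+2 v) (cong (λ x → 2 * suc x) (sym (toℕ-fromℕ v)))

entries-∷ʳ : ∀ vs v → entries (vs ∷ʳ v) ≡ entries vs ++ comma ∷ map digit (digits (fromℕ v))
entries-∷ʳ vs v = trans (concatMap-++ _ vs (v ∷ [])) (cong (entries vs ++_) (++-identityʳ _))

reverse-∷-entries : ∀ v P w → entries (reverse (v ∷ P)) ++ w ≡
                    entries (reverse P) ++ comma ∷ map digit (digits (fromℕ v)) ++ w
reverse-∷-entries v P w = begin
  entries (reverse (v ∷ P)) ++ w
    ≡⟨ cong (λ u → entries u ++ w) (unfold-reverse v P) ⟩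
  entries (reverse P ∷ʳ v) ++ w
    ≡⟨ cong (_++ w) (entries-∷ʳ (reverse P) v) ⟩
  (entries (reverse P) ++ comma ∷ map digit (digits (fromℕ v))) ++ w
    ≡⟨ ++-assoc (entries (reverse P)) _ w ⟩
  entries (reverse P) ++ comma ∷ map digit (digits (fromℕ v)) ++ w ∎
  where open ≡-Reasoning

read-sound : ∀ w c b P {R} → read w c b P ≡ just R →
             entries (reverse P) ++ w ≡ entries (reverse R) × length R ≡ length P + c
read-sound []            zero    zero P refl = ++-identityʳ _ , sym (+-identityʳ _)
read-sound (comma ∷ w)   (suc c) b P eq with e , l ← read-sound w c b (0 ∷ P) eq =
  trans (sym (reverse-∷-entries 0 P w)) e , trans l (sym (+-suc (length P) c))
read-sound (digit d ∷ w) c       b (v ∷ P) eq with v + value d ≤? b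
... | yes _ with e , l ← read-sound w c _ (v + (v + value d) ∷ P) eq = trans step-digit e , l
  where
  open ≡-Reasoning
  v′ = v + (v + value d)
  step-digit : entries (reverse (v ∷ P)) ++ digit d ∷ w ≡ entries (reverse (v′ ∷ P)) ++ w
  step-digit = begin
    entries (reverse (v ∷ P)) ++ digit d ∷ w
      ≡⟨ reverse-∷-entries v P _ ⟩
    entries (reverse P) ++ comma ∷ map digit (digits (fromℕ v)) ++ digit d ∷ w
      ≡⟨ cong (λ u → entries (reverse P) ++ comma ∷ u) (++-assoc (map digit (digits (fromℕ v))) _ w) ⟨
    entries (reverse P) ++ comma ∷ (map digit (digits (fromℕ v)) ∷ʳ digit d) ++ w
      ≡⟨ cong (λ u → entries (reverse P) ++ comma ∷ u ++ w)
           (trans (sym (map-++ digit (digits (fromℕ v)) _)) (cong (map digit) (digits-∷ʳ v d))) ⟩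
    entries (reverse P) ++ comma ∷ map digit (digits (fromℕ v′)) ++ w
      ≡⟨ reverse-∷-entries v′ P w ⟨
    entries (reverse (v′ ∷ P)) ++ w ∎

-- The budget has already paid for `v`, so passing to `2v + d` charges only the increment
-- `v + value d`.
read-digit : ∀ d w c b v P → v + (v + value d) ≤ b →
             read (digit d ∷ w) c (b ∸ v) (v ∷ P) ≡
             read w c (b ∸ (v + (v + value d))) (v + (v + value d) ∷ P)
read-digit d w c b v P v′≤b with v + value d ≤? b ∸ v
... | yes _ = cong (λ k → read w c k (v + (v + value d) ∷ P)) (∸-+-assoc b v (v + value d))
... | no ¬p = contradiction (m+n≤o⇒m≤o∸n (v + value d) (subst (_≤ b) (+-comm v _) v′≤b)) ¬p

-- The partial values in Horner's rule never exceed the final one, so a budget that suffices for the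
-- entry suffices throughout.
read-digits : ∀ m {w c b P} → ℕᵇ.toℕ m ≤ b →
              read (map digit (digits m) ++ w) c b (0 ∷ P) ≡ read w c (b ∸ ℕᵇ.toℕ m) (ℕᵇ.toℕ m ∷ P)
read-digits zero _ = refl
read-digits 2[1+ m ] {w} {c} {b} {P} m≤b rewrite map-++ digit (digits m) (𝟐 ∷ [])
  | ++-assoc (map digit (digits m)) (digit 𝟐 ∷ []) w | sym (double+2 (ℕᵇ.toℕ m)) =
  trans (read-digits m (≤-trans (m≤m+n _ _) m≤b)) (read-digit 𝟐 w c b (ℕᵇ.toℕ m) P m≤b)
read-digits 1+[2 m ] {w} {c} {b} {P} m≤b rewrite map-++ digit (digits m) (𝟏 ∷ [])
  | ++-assoc (map digit (digits m)) (digit 𝟏 ∷ []) w | sym (double+1 (ℕᵇ.toℕ m)) =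
  trans (read-digits m (≤-trans (m≤m+n _ _) m≤b)) (read-digit 𝟏 w c b (ℕᵇ.toℕ m) P m≤b)

read-complete : ∀ vs P → read (entries vs) (length vs) (sum vs) P ≡ just (vs ʳ++ P)
read-complete []       P = refl
read-complete (v ∷ vs) P = begin
  read (map digit (digits (fromℕ v)) ++ entries vs) (length vs) (v + sum vs) (0 ∷ P)
    ≡⟨ read-digits (fromℕ v) (subst (_≤ v + sum vs) (sym (toℕ-fromℕ v)) (m≤m+n v _)) ⟩
  read (entries vs) (length vs) (v + sum vs ∸ ℕᵇ.toℕ (fromℕ v)) (ℕᵇ.toℕ (fromℕ v) ∷ P)
    ≡⟨ cong (λ x → read (entries vs) (length vs) (v + sum vs ∸ x) (x ∷ P)) (toℕ-fromℕ v) ⟩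
  read (entries vs) (length vs) (v + sum vs ∸ v) (v ∷ P)
    ≡⟨ cong (λ b → read (entries vs) (length vs) b (v ∷ P)) (m+n∸m≡n v (sum vs)) ⟩
  read (entries vs) (length vs) (sum vs) (v ∷ P)
    ≡⟨ read-complete vs (v ∷ P) ⟩
  just (vs ʳ++ v ∷ P) ∎
  where open ≡-Reasoning

-- Programs on stacks and their compilation to Turing machines

⊤-finite : Finite ⊤
⊤-finite = 1 , ↔-sym Fin.1↔⊤

Bool-finite : Finite Bool
Bool-finite = 2 , ↔-sym Fin.2↔Bool

⊎-finite : ∀ {A B} → Finite A → Finite B → Finite (A ⊎ B)
⊎-finite (_ , f) (_ , g) = _ , ↔-trans (f ⊎-↔ g) (↔-sym Fin.+↔⊎)

Maybe-finite : ∀ {A} → Finite A → Finite (Maybe A)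
Maybe-finite {A} f = _ , ↔-trans Maybe↔⊤⊎ (proj₂ (⊎-finite ⊤-finite f))
  where
  Maybe↔⊤⊎ : Maybe A ↔ (⊤ ⊎ A)
  Maybe↔⊤⊎ = mk↔ₛ′ (maybe′ inj₂ (inj₁ tt)) (λ { (inj₁ tt) → nothing ; (inj₂ a) → just a })
    (λ { (inj₁ tt) → refl ; (inj₂ a) → refl }) (λ { nothing → refl ; (just a) → refl })

module StackProgram {A : Set} (A-finite : Finite A) (extra : ℕ) where

  Stack : Set
  Stack = Fin (suc extra)

  Test : Set
  Test = Maybe A → Bool

  infixr 5 _⨾_

  data Program : Set where
    skip   : Program
    push   : Stack → A → Program
    pop    : Stack → Program
    halt   : Verdict → Program
    _⨾_    : Program → Program → Program
    branch : Stack → Test → Program → Program → Program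
    while  : Stack → Test → Program → Program

  Memory : Set
  Memory = Vec (List A) (suc extra)

  data Outcome : Set where
    ret  : Memory → Outcome
    done : Verdict → Outcome

  top : Memory → Stack → Maybe A
  top σ s = List.head (lookup σ s)

  private variable
    p q   : Program
    s     : Stack
    f     : Test
    a     : A
    σ σ′  : Memory
    o     : Outcome
    v     : Verdict
    t t′  : ℕ

  infix 4 _⊢_⇒_[_]

  -- The index t bounds the number of steps of the machine compiled below.
  data _⊢_⇒_[_] : Program → Memory → Outcome → ℕ → Set where
    skip   : skip ⊢ σ ⇒ ret σ [ 1 ]
    push   : push s a ⊢ σ ⇒ ret (σ [ s ]%= (a ∷_)) [ 2 ]
    pop    : pop s ⊢ σ ⇒ ret (σ [ s ]%= drop 1) [ 1 ]
    halt   : halt v ⊢ σ ⇒ done v [ 0 ]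
    _⨾_    : p ⊢ σ ⇒ ret σ′ [ t ] → q ⊢ σ′ ⇒ o [ t′ ] → p ⨾ q ⊢ σ ⇒ o [ t + t′ ]
    stop   : p ⊢ σ ⇒ done v [ t ] → p ⨾ q ⊢ σ ⇒ done v [ t ]
    then   : f (top σ s) ≡ true → p ⊢ σ ⇒ o [ t ] → branch s f p q ⊢ σ ⇒ o [ suc t ]
    else   : f (top σ s) ≡ false → q ⊢ σ ⇒ o [ t ] → branch s f p q ⊢ σ ⇒ o [ suc t ]
    loop   : f (top σ s) ≡ true → p ⊢ σ ⇒ ret σ′ [ t ] → while s f p ⊢ σ′ ⇒ o [ t′ ] →
             while s f p ⊢ σ ⇒ o [ suc (t + t′) ]
    abort  : f (top σ s) ≡ true → p ⊢ σ ⇒ done v [ t ] → while s f p ⊢ σ ⇒ done v [ suc t ]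
    exit   : f (top σ s) ≡ false → while s f p ⊢ σ ⇒ ret σ [ 1 ]
    within : p ⊢ σ ⇒ o [ t ] → t ≤ t′ → p ⊢ σ ⇒ o [ t′ ]

  -- Compilation and simulation

  Symbol : Set
  Symbol = Maybe A

  -- The program counter. The extra `nothing` of `branch` and `while` is the place of the test. A
  -- `push` has two places: a transition writes before it moves, whereas the head must first move to
  -- the new cell.
  Location : Program → Set
  Location skip             = ⊤
  Location (push _ _)       = Bool
  Location (pop _)          = ⊤
  Location (halt _)         = ⊤
  Location (p ⨾ q)          = Location p ⊎ Location q
  Location (branch _ _ p q) = Maybe (Location p ⊎ Location q)
  Location (while _ _ p)    = Maybe (Location p)

  Location-finite : ∀ p → Finite (Location p)
  Location-finite skip             = ⊤-finite
  Location-finite (push _ _)       = Bool-finite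
  Location-finite (pop _)          = ⊤-finite
  Location-finite (halt _)         = ⊤-finite
  Location-finite (p ⨾ q)          = ⊎-finite (Location-finite p) (Location-finite q)
  Location-finite (branch _ _ p q) = Maybe-finite (⊎-finite (Location-finite p) (Location-finite q))
  Location-finite (while _ _ p)    = Maybe-finite (Location-finite p)

  entry : ∀ p → Location p
  entry skip             = tt
  entry (push _ _)       = false
  entry (pop _)          = tt
  entry (halt _)         = tt
  entry (p ⨾ q)          = inj₁ (entry p)
  entry (branch _ _ _ _) = nothing
  entry (while _ _ _)    = nothing

  Tops : Set
  Tops = Vec Symbol (suc extra)

  -- The top of a stack is under the head.  Stack 0 grows to the left, so that
  -- the input is initially on it, first letter on top; the others grow to the right.
  up down : Stack → Move
  up zero      = left
  up (suc _)   = right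
  down zero    = right
  down (suc _) = left

  idle : Tops → Vec (Symbol × Move) (suc extra)
  idle = Vec.map (_, stay)

  Transition : Set → Set
  Transition L = Verdict ⊎ (Maybe L × Vec (Symbol × Move) (suc extra))

  -- Embeds the transitions of a part into the whole: `e` translates its locations and `x` is where
  -- control goes when the part ends.
  relocate : ∀ {L L′ : Set} → (L → Maybe L′) → Maybe L′ → Transition L → Transition L′
  relocate e x = map₂ (map₁ (maybe′ e x))

  transition : ∀ p → Location p → Tops → Transition (Location p)
  transition skip       tt    hs = inj₂ (nothing , idle hs)
  transition (push s a) false hs = inj₂ (just true , idle hs [ s ]≔ (lookup hs s , up s))
  transition (push s a) true  hs = inj₂ (nothing , idle hs [ s ]≔ (just a , stay))
  transition (pop s)    tt    hs = inj₂ (nothing , idle hs [ s ]≔ (lookup hs s , down s))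
  transition (halt v)   tt    hs = inj₁ v
  transition (p ⨾ q) (inj₁ l) hs = relocate (just ∘ inj₁) (just (inj₂ (entry q))) (transition p l hs)
  transition (p ⨾ q) (inj₂ l) hs = relocate (just ∘ inj₂) nothing (transition q l hs)
  transition (branch s f p q) nothing hs =
    inj₂ (just (just (if f (lookup hs s) then inj₁ (entry p) else inj₂ (entry q))) , idle hs)
  transition (branch s f p q) (just (inj₁ l)) hs = relocate (just ∘ just ∘ inj₁) nothing (transition p l hs)
  transition (branch s f p q) (just (inj₂ l)) hs = relocate (just ∘ just ∘ inj₂) nothing (transition q l hs)
  transition (while s f p) nothing  hs =
    inj₂ ((if f (lookup hs s) then just (just (entry p)) else nothing) , idle hs)
  transition (while s f p) (just l) hs = relocate (just ∘ just) (just nothing) (transition p l hs)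

  module Compile (main : Program) where

    machine : TM A
    machine = record
      { Symbol          = Symbol
      ; symbol-finite   = Maybe-finite A-finite
      ; blank           = nothing
      ; input           = just
      ; input-injective = just-injective
      ; input≢blank     = λ _ ()
      ; State           = Maybe (Location main)
      ; state-finite    = Maybe-finite (Location-finite main)
      ; start           = just (entry main)
      ; extraTapes      = extra
      -- Running off the end of `main` gets an arbitrary verdict; the runs in `main-halts` all end
      -- in `halt`.
      ; δ               = maybe′ (transition main) (λ _ → inj₁ reject)
      }

    open Run machine
    open TM machine using (δ; State)

    -- Only the head and the cells on this side are constrained: `pop` moves without erasing, and a
    -- later `push` overwrites what was left behind.
    below : Stack → Tape → List Symbol
    below zero    t = after t
    below (suc _) t = before t

    cells : Stack → Tape → List Symbol
    cells s t = head t ∷ below s t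

    -- An empty stack may end with the listed cells or with one explicit blank, since moving beyond
    -- the listed cells creates a blank.
    data Holds : List A → List Symbol → Set where
      end    : Holds [] []
      bottom : Holds [] (nothing ∷ [])
      item   : ∀ {x xs cs} → Holds xs cs → Holds (x ∷ xs) (just x ∷ cs)

    Tapes : Set
    Tapes = Vec Tape (suc extra)

    record Represents (σ : Memory) (ts : Tapes) : Set where
      constructor representing
      field holds : ∀ s → Holds (lookup σ s) (cells s (lookup ts s))

    open Represents

    holds-head : ∀ {xs c cs} → Holds xs (c ∷ cs) → c ≡ List.head xs
    holds-head bottom   = refl
    holds-head (item _) = refl

    represents-top : ∀ {ts} → Represents σ ts → ∀ s → lookup (Vec.map head ts) s ≡ top σ s
    represents-top {ts = ts} rep s = trans (Vec.lookup-map s head ts) (holds-head (holds rep s))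

    holds-pop : ∀ {xs} s t → Holds xs (cells s t) → Holds (drop 1 xs) (cells s (act (head t , down s) t))
    holds-pop zero    (tape _ _ [])      bottom         = bottom
    holds-pop zero    (tape _ _ [])      (item end)     = bottom
    holds-pop zero    (tape _ _ (_ ∷ _)) (item h)       = h
    holds-pop (suc _) (tape [] _ _)      bottom         = bottom
    holds-pop (suc _) (tape [] _ _)      (item end)     = bottom
    holds-pop (suc _) (tape (_ ∷ _) _ _) (item h)       = h

    holds-push : ∀ {xs a} s t → Holds xs (cells s t) →
                 Holds (a ∷ xs) (cells s (act (just a , stay) (act (head t , up s) t)))
    holds-push zero    (tape [] _ _)      h = item h
    holds-push zero    (tape (_ ∷ _) _ _) h = item h
    holds-push (suc _) (tape _ _ [])      h = item h
    holds-push (suc _) (tape _ _ (_ ∷ _)) h = item h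

    represents-update : ∀ {ts g h} s → Represents σ ts →
      (∀ t → Holds (lookup σ s) (cells s t) → Holds (g (lookup σ s)) (cells s (h t))) →
      Represents (σ [ s ]%= g) (ts [ s ]%= h)
    represents-update {σ} {ts} {g} {h} s rep upd .holds s′ with s′ Fin.≟ s
    ... | yes refl = subst₂ (λ xs t → Holds xs (cells s t))
                       (sym (Vec.lookup∘updateAt s σ)) (sym (Vec.lookup∘updateAt s ts)) (upd _ (holds rep s))
    ... | no s′≢s  = subst₂ (λ xs t → Holds xs (cells s′ t))
                       (sym (Vec.lookup∘updateAt′ s′ s s′≢s σ)) (sym (Vec.lookup∘updateAt′ s′ s s′≢s ts)) (holds rep s′)

    idle-act : ∀ {n} (ts : Vec Tape n) → zipWith act (Vec.map (_, stay) (Vec.map head ts)) ts ≡ ts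
    idle-act []       = refl
    idle-act (t ∷ ts) = cong (t ∷_) (idle-act ts)

    update-act : ∀ {n} (ts : Vec Tape n) s (b : Symbol × Move) →
                 zipWith act (Vec.map (_, stay) (Vec.map head ts) [ s ]≔ b) ts ≡ ts [ s ]%= act b
    update-act (t ∷ ts) zero    b = cong (_ ∷_) (idle-act ts)
    update-act (t ∷ ts) (suc s) b = cong (t ∷_) (update-act ts s b)

    shift-act : ∀ {n} (ts : Vec Tape n) s m →
      zipWith act (Vec.map (_, stay) (Vec.map head ts) [ s ]≔ (lookup (Vec.map head ts) s , m)) ts
      ≡ ts [ s ]%= λ t → act (head t , m) t
    shift-act (t ∷ ts) zero    m = cong (_ ∷_) (idle-act ts)
    shift-act (t ∷ ts) (suc s) m = cong (t ∷_) (shift-act ts s m)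

    Halts : State → Tapes → ℕ → Verdict → Set
    Halts l ts t v = ∃[ t′ ] (t′ ≤ t × config l ts ⇓[ t′ ] v)

    halts-≤ : ∀ {l ts} → t ≤ t′ → Halts l ts t v → Halts l ts t′ v
    halts-≤ t≤ (_ , ≤t , r) = _ , ≤-trans ≤t t≤ , r

    halts-step : ∀ {l l′ as ts ts′} → δ l (Vec.map head ts) ≡ inj₂ (l′ , as) → zipWith act as ts ≡ ts′ →
                 Halts l′ ts′ t v → Halts l ts (suc t) v
    halts-step eq refl (_ , t≤ , r) = _ , s≤s t≤ , moves (cong (map₂ _) eq) r

    Embeds : ∀ p → (Location p → State) → State → Set
    Embeds p e x = ∀ l hs → δ (e l) hs ≡ relocate e x (transition p l hs)

    relocate-∘ : ∀ {L L′ L″ : Set} {e : L → Maybe L′} {x} {e′ : L′ → Maybe L″} {x′} τ →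
      relocate e′ x′ (relocate e x τ) ≡ relocate (λ l → maybe′ e′ x′ (e l)) (maybe′ e′ x′ x) τ
    relocate-∘ (inj₁ _)             = refl
    relocate-∘ (inj₂ (just _ , _))  = refl
    relocate-∘ (inj₂ (nothing , _)) = refl

    Continues : State → Outcome → ℕ → Verdict → Set
    Continues x (ret σ)  t v = ∀ {ts} → Represents σ ts → Halts x ts t v
    Continues x (done u) t v = u ≡ v

    embeds-part : ∀ r {p e x} y (i : Location p → Location r) →
      (∀ l hs → transition r (i l) hs ≡ relocate (just ∘ i) y (transition p l hs)) →
      Embeds r e x → Embeds p (e ∘ i) (maybe′ e x y)
    embeds-part r {p} y i eq emb l hs =
      trans (emb (i l) hs) (trans (cong (relocate _ _) (eq l hs)) (relocate-∘ (transition p l hs)))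

    test-step : ∀ {f s b l ts} {k : Bool → State} → Represents σ ts → f (top σ s) ≡ b →
      (∀ hs → δ l hs ≡ inj₂ (k (f (lookup hs s)) , idle hs)) →
      Halts (k b) ts t v → Halts l ts (suc t) v
    test-step {f = f} {s} {ts = ts} {k} rep eq emb =
      halts-step (trans (emb _) (cong (λ b → inj₂ (k b , _)) (trans (cong f (represents-top rep s)) eq)))
        (idle-act ts)

    -- Continuation-passing form: a run of p embedded in main is prolonged by
    -- the run of whatever follows p there.
    sound : ∀ {ts} → p ⊢ σ ⇒ o [ t ] → ∀ e x → Embeds p e x → Represents σ ts →
            Continues x o t′ v → Halts (e (entry p)) ts (t + t′) v
    sound {ts = ts} skip e x emb rep k = halts-step (emb tt _) (idle-act ts) (k rep)
    sound {ts = ts} (push {s = s}) e x emb rep k =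
      halts-step (emb false _) (shift-act ts s (up s))
        (halts-step (emb true _) (update-act (ts [ s ]%= _) s _)
          (k (subst (Represents _) (sym (updateAt-∘ ts s)) (represents-update s rep (holds-push s)))))
      where
      updateAt-∘ : ∀ {n} (ts : Vec Tape n) s {g h} → (ts [ s ]%= g) [ s ]%= h ≡ ts [ s ]%= (h ∘ g)
      updateAt-∘ (_ ∷ _)  zero    = refl
      updateAt-∘ (t ∷ ts) (suc s) = cong (t ∷_) (updateAt-∘ ts s)
    sound {ts = ts} (pop {s = s}) e x emb rep k =
      halts-step (emb tt _) (shift-act ts s (down s)) (k (represents-update s rep (holds-pop s)))
    sound halt e x emb rep refl = 0 , z≤n , halts (cong (map₂ _) (emb tt _))
    sound (_⨾_ {p = p} {t = t} {q} {t′ = t′} d d′) e x emb rep k =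
      halts-≤ (≤-reflexive (sym (+-assoc t t′ _)))
        (sound d _ _ (embeds-part (p ⨾ q) (just (inj₂ (entry q))) inj₁ (λ _ _ → refl) emb) rep
          (λ rep′ → sound d′ _ _ (embeds-part (p ⨾ q) nothing inj₂ (λ _ _ → refl) emb) rep′ k))
    sound (stop {p = p} {q = q} d) e x emb rep refl =
      sound d _ _ (embeds-part (p ⨾ q) (just (inj₂ (entry q))) inj₁ (λ _ _ → refl) emb) rep refl
    sound (then {f} {s = s} {p = p} {q = q} eq d) e x emb rep k =
      test-step {f = f} {k = λ b → e (just (if b then _ else _))} rep eq (emb nothing)
        (sound d _ _ (embeds-part (branch s f p q) nothing (just ∘ inj₁) (λ _ _ → refl) emb) rep k)
    sound (else {f} {s = s} {q = q} {p = p} eq d) e x emb rep k =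
      test-step {f = f} {k = λ b → e (just (if b then _ else _))} rep eq (emb nothing)
        (sound d _ _ (embeds-part (branch s f p q) nothing (just ∘ inj₂) (λ _ _ → refl) emb) rep k)
    sound (loop {f} {s = s} {p = p} {t = t} {t′ = t′} eq d d′) e x emb rep k =
      test-step {f = f} {k = λ b → maybe′ e x (if b then _ else _)} rep eq (emb nothing)
        (halts-≤ (≤-reflexive (sym (+-assoc t t′ _)))
          (sound d _ _ (embeds-part (while s f p) (just nothing) just (λ _ _ → refl) emb) rep
            (λ rep′ → sound d′ e x emb rep′ k)))
    sound (abort {f} {s = s} {p = p} eq d) e x emb rep refl =
      test-step {f = f} {k = λ b → maybe′ e x (if b then _ else _)} rep eq (emb nothing)
        (sound d _ _ (embeds-part (while s f p) (just nothing) just (λ _ _ → refl) emb) rep refl)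
    sound (exit {f = f} eq) e x emb rep k =
      test-step {f = f} {k = λ b → maybe′ e x (if b then _ else _)} rep eq (emb nothing) (k rep)
    sound (within d t≤) e x emb rep k = halts-≤ (+-monoˡ-≤ _ t≤) (sound d e x emb rep k)

    represents-initial : ∀ w → Represents (w ∷ replicate extra []) (inputTape w ∷ replicate extra blankTape)
    represents-initial []      .holds zero    = bottom
    represents-initial (a ∷ w) .holds zero    = item (holds-all w)
      where
      holds-all : ∀ w → Holds w (List.map just w)
      holds-all []      = end
      holds-all (_ ∷ w) = item (holds-all w)
    represents-initial w       .holds (suc s) = empty s
      where
      empty : ∀ {n} (s : Fin n) → let t = lookup (replicate n blankTape) s in
              Holds (lookup (replicate n []) s) (head t ∷ before t)
      empty zero    = bottom
      empty (suc s) = empty s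

    main-halts : ∀ w → main ⊢ w ∷ replicate extra [] ⇒ done v [ t ] →
                 ∃[ t′ ] (t′ ≤ t × initial w ⇓[ t′ ] v)
    main-halts {t = t} w d = halts-≤ (≤-reflexive (+-identityʳ t))
      (sound d just nothing (λ l hs → sym (relocate-id (transition main l hs))) (represents-initial w) refl)
      where
      relocate-id : ∀ {L} (τ : Transition L) → relocate just nothing τ ≡ τ
      relocate-id (inj₁ _)             = refl
      relocate-id (inj₂ (just _ , _))  = refl
      relocate-id (inj₂ (nothing , _)) = refl

  open Compile using (machine; main-halts)

  program-decides : ∀ main (L : List A → Set) →
    (∀ w → ∃[ v ] ∃[ t ] (main ⊢ w ∷ replicate extra [] ⇒ done v [ t ] × (v ≡ accept ⇔ L w))) →
    Decides (machine main) L
  program-decides main L runs w with v , _ , run , correct ← runs w with t , _ , run′ ← main-halts main w run =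
    t , v , run′ , correct

  program-polynomial : ∀ main {I : Set} (word : I → List A) (size : I → ℕ) a b →
    (∀ x → ∃[ v ] ∃[ t ] (main ⊢ word x ∷ replicate extra [] ⇒ done v [ t ] × t ≤ a * size x ^ b + a)) →
    PolynomialTime (machine main) word size
  program-polynomial main word size a b runs = a , b , λ x →
    let v , _ , run , t≤ = runs x
        t′ , t′≤ , run′ = main-halts main (word x) run
    in t′ , v , run′ , ≤-trans t′≤ t≤

-- The program

Letter-finite : Finite Letter
Letter-finite = 5 , mk↔ₛ′ to from to∘from from∘to
  where
  to : Letter → Fin 5
  to (step 𝗇)  = 0F
  to (step 𝖾)  = 1F
  to (digit 𝟏) = 2F
  to (digit 𝟐) = 3F
  to comma     = 4F
  from : Fin 5 → Letter
  from 0F = step 𝗇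
  from 1F = step 𝖾
  from 2F = digit 𝟏
  from 3F = digit 𝟐
  from 4F = comma
  to∘from : ∀ i → to (from i) ≡ i
  to∘from 0F = refl
  to∘from 1F = refl
  to∘from 2F = refl
  to∘from 3F = refl
  to∘from 4F = refl
  from∘to : ∀ a → from (to a) ≡ a
  from∘to (step 𝗇)  = refl
  from∘to (step 𝖾)  = refl
  from∘to (digit 𝟏) = refl
  from∘to (digit 𝟐) = refl
  from∘to comma     = refl

open StackProgram Letter-finite 5

-- I: the input, later the path; Q: the reversed path, later auxiliary;
-- F: a counter for the entries of α, later the queue; M: what remains of the
-- total n of α, later the largest number; P: the pool; X: auxiliary.
pattern I = 0F
pattern Q = 1F
pattern F = 2F
pattern M = 3F
pattern P = 4F
pattern X = 5F

mem : (i q f m p x : List Letter) → Memory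
mem i q f m p x = i ∷ q ∷ f ∷ m ∷ p ∷ x ∷ []

-- Reusing an input letter for unary counting lets the stack alphabet be `Letter` itself.
tick : Letter
tick = digit 𝟏

ticks : ℕ → List Letter → List Letter
ticks zero    xs = xs
ticks (suc r) xs = tick ∷ ticks r xs

numbers : List ℕ → List Letter
numbers []       = []
numbers (r ∷ rs) = ticks r (comma ∷ numbers rs)

ticks-∷ : ∀ r xs → ticks r (tick ∷ xs) ≡ tick ∷ ticks r xs
ticks-∷ zero    xs = refl
ticks-∷ (suc r) xs = cong (tick ∷_) (ticks-∷ r xs)

ticks-+ : ∀ r s xs → ticks (r + s) xs ≡ ticks r (ticks s xs)
ticks-+ zero    s xs = refl
ticks-+ (suc r) s xs = cong (tick ∷_) (ticks-+ r s xs)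

nonempty isTick isComma isDigit is𝟐 isStep is𝗇 : Test
nonempty nothing        = false
nonempty (just _)       = true
isTick (just (digit 𝟏)) = true
isTick _                = false
isComma (just comma)    = true
isComma _               = false
isDigit (just (digit _)) = true
isDigit _               = false
is𝟐 (just (digit 𝟐))    = true
is𝟐 _                   = false
isStep (just (step _))  = true
isStep _                = false
is𝗇 (just (step 𝗇))     = true
is𝗇 _                   = false

nonempty-ticks : ∀ r x xs → nonempty (List.head (ticks r (x ∷ xs))) ≡ true
nonempty-ticks zero    x xs = refl
nonempty-ticks (suc r) x xs = refl

≤-slack : ∀ {m n} k → m + k ≡ n → m ≤ n
≤-slack k refl = m≤m+n _ k

-- Memory seen as a function of two of its stacks, so that the moving programs are verified once for
-- all pairs; every instance holds by computation.
record View (s s′ : Stack) (m : List Letter → List Letter → Memory) : Set where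
  constructor view
  field
    first   : ∀ xs ys → lookup (m xs ys) s ≡ xs
    update  : ∀ f xs ys → m xs ys [ s ]%= f ≡ m (f xs) ys
    update′ : ∀ f xs ys → m xs ys [ s′ ]%= f ≡ m xs (f ys)

moveTicks moveNumber moveNumbers : Stack → Stack → Program
moveTicks   s s′ = while s isTick (pop s ⨾ push s′ tick)
moveNumber  s s′ = push s′ comma ⨾ moveTicks s s′ ⨾ pop s
moveNumbers s s′ = while s nonempty (moveNumber s s′)

-- The height of the stack `numbers rs`, each number having its own separator.
size : List ℕ → ℕ
size rs = sum (map suc rs)

module _ {s s′ m} (V : View s s′ m) where
  open View V

  test-view : ∀ (f : Test) {b} xs ys → f (List.head xs) ≡ b → f (top (m xs ys) s) ≡ b
  test-view f xs ys eq = trans (cong (f ∘ List.head) (first xs ys)) eq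

  pop-view : ∀ xs ys → pop s ⊢ m xs ys ⇒ ret (m (drop 1 xs) ys) [ 1 ]
  pop-view xs ys = subst (λ σ → pop s ⊢ m xs ys ⇒ ret σ [ 1 ]) (update (drop 1) xs ys) pop

  push-view : ∀ a xs ys → push s′ a ⊢ m xs ys ⇒ ret (m xs (a ∷ ys)) [ 2 ]
  push-view a xs ys = subst (λ σ → push s′ a ⊢ m xs ys ⇒ ret σ [ 2 ]) (update′ (a ∷_) xs ys) push

  move-ticks : ∀ r {xs ys} → isTick (List.head xs) ≡ false →
               moveTicks s s′ ⊢ m (ticks r xs) ys ⇒ ret (m xs (ticks r ys)) [ r * 4 + 1 ]
  move-ticks zero    {xs} {ys} eq = exit (test-view isTick xs ys eq)
  move-ticks (suc r) {xs} {ys} eq =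
    loop (test-view isTick (tick ∷ ticks r xs) ys refl) (pop-view _ ys ⨾ push-view tick _ ys)
      (subst (λ zs → moveTicks s s′ ⊢ m (ticks r xs) (tick ∷ ys) ⇒ ret (m xs zs) [ r * 4 + 1 ])
        (ticks-∷ r ys) (move-ticks r eq))

  move-number : ∀ r {xs ys} →
    moveNumber s s′ ⊢ m (ticks r (comma ∷ xs)) ys ⇒ ret (m xs (ticks r (comma ∷ ys))) [ r * 4 + 4 ]
  move-number r {xs} {ys} =
    within (push-view comma _ ys ⨾ move-ticks r refl ⨾ pop-view (comma ∷ xs) _) (≤-reflexive (eq r))
    where
    eq : ∀ r → 2 + (r * 4 + 1 + 1) ≡ r * 4 + 4
    eq = solve-∀

  move-numbers : ∀ rs {rs′} →
    moveNumbers s s′ ⊢ m (numbers rs) (numbers rs′) ⇒ ret (m [] (numbers (rs ʳ++ rs′))) [ size rs * 5 + 1 ]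
  move-numbers []       = exit (test-view nonempty [] _ refl)
  move-numbers (r ∷ rs) {rs′} =
    within (loop (test-view nonempty _ _ (nonempty-ticks r comma (numbers rs))) (move-number r) (move-numbers rs {r ∷ rs′}))
      (≤-slack r (eq r (size rs)))
    where
    eq : ∀ r z → suc (r * 4 + 4 + (z * 5 + 1)) + r ≡ (suc r + z) * 5 + 1
    eq = solve-∀

X→P : ∀ {i q f m} → View X P (λ x p → mem i q f m p x)
P→M : ∀ {i q f x} → View P M (λ p m → mem i q f m p x)
M→X : ∀ {i q f p} → View M X (λ m x → mem i q f m p x)
X→M : ∀ {i q f p} → View X M (λ x m → mem i q f m p x)
M→Q : ∀ {i f p x} → View M Q (λ m q → mem i q f m p x)
F→P : ∀ {i q m x} → View F P (λ f p → mem i q f m p x)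
Q→P : ∀ {i f m x} → View Q P (λ q p → mem i q f m p x)
F→Q : ∀ {i m p x} → View F Q (λ f q → mem i q f m p x)
Q→F : ∀ {i m p x} → View Q F (λ q f → mem i q f m p x)
X→P = view (λ _ _ → refl) (λ _ _ _ → refl) (λ _ _ _ → refl)
P→M = view (λ _ _ → refl) (λ _ _ _ → refl) (λ _ _ _ → refl)
M→X = view (λ _ _ → refl) (λ _ _ _ → refl) (λ _ _ _ → refl)
X→M = view (λ _ _ → refl) (λ _ _ _ → refl) (λ _ _ _ → refl)
M→Q = view (λ _ _ → refl) (λ _ _ _ → refl) (λ _ _ _ → refl)
F→P = view (λ _ _ → refl) (λ _ _ _ → refl) (λ _ _ _ → refl)
Q→P = view (λ _ _ → refl) (λ _ _ _ → refl) (λ _ _ _ → refl)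
F→Q = view (λ _ _ → refl) (λ _ _ _ → refl) (λ _ _ _ → refl)
Q→F = view (λ _ _ → refl) (λ _ _ _ → refl) (λ _ _ _ → refl)

-- Splitting off the path

storePath restorePath : Program
storePath = while I isStep
  (branch I is𝗇
    (pop I ⨾ push Q (step 𝗇) ⨾ push F tick ⨾ push M tick)
    (pop I ⨾ push Q (step 𝖾)))
restorePath = while Q nonempty
  (branch Q is𝗇 (pop Q ⨾ push I (step 𝗇)) (pop Q ⨾ push I (step 𝖾)))

store-path : ∀ p {r w f m} → isStep (List.head w) ≡ false →
  storePath ⊢ mem (map step p ++ w) (map step r) f m [] [] ⇒
    ret (mem w (map step (p ʳ++ r)) (ticks (#[ 𝗇 ] p) f) (ticks (#[ 𝗇 ] p) m) [] []) [ length p * 9 + 1 ]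
store-path [] eq = exit eq
store-path (𝗇 ∷ p) {r} {w} {f} {m} eq
  rewrite sym (ticks-∷ (#[ 𝗇 ] p) f) | sym (ticks-∷ (#[ 𝗇 ] p) m) =
  loop refl (then refl (pop ⨾ push ⨾ push ⨾ push)) (store-path p {𝗇 ∷ r} eq)
store-path (𝖾 ∷ p) {r} eq =
  loop refl (within (else refl (pop ⨾ push)) (m≤m+n _ 4)) (store-path p {𝖾 ∷ r} eq)

restore-path : ∀ p {r f m pool x} →
  restorePath ⊢ mem (map step r) (map step p) f m pool x ⇒
    ret (mem (map step (p ʳ++ r)) [] f m pool x) [ length p * 5 + 1 ]
restore-path []          = exit refl
restore-path (𝗇 ∷ p) {r} = loop refl (then refl (pop ⨾ push)) (restore-path p {𝗇 ∷ r})
restore-path (𝖾 ∷ p) {r} = loop refl (else refl (pop ⨾ push)) (restore-path p {𝖾 ∷ r})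

-- Converting the weight to unary

-- Horner's rule in unary: `doubleTop` transfers `v` ticks to `X` together with `v` more from the
-- budget, `addDigit` takes the digit from the budget, and the new value returns to the pool.
takeTick doubleTop addDigit readComma readDigit readEntries checkCounters : Program
takeTick  = branch M isTick (pop M ⨾ push X tick) (halt reject)
doubleTop = while P isTick (pop P ⨾ push X tick ⨾ takeTick)
addDigit  = takeTick ⨾ branch I is𝟐 takeTick skip
readComma = branch F isTick (pop F ⨾ pop I ⨾ push P comma) (halt reject)
readDigit = branch P nonempty
  (doubleTop ⨾ addDigit ⨾ pop I ⨾ moveTicks X P)
  (halt reject)
readEntries = while I nonempty
  (branch I isComma readComma (branch I isDigit readDigit (halt reject)))
checkCounters = branch F isTick (halt reject) (branch M isTick (halt reject) skip)

double-top : ∀ v {b i q f p x} →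
  doubleTop ⊢ mem i q f (ticks (v + b) []) (ticks v (comma ∷ p)) x ⇒
    ret (mem i q f (ticks b []) (comma ∷ p) (ticks (v + v) x)) [ v * 8 + 1 ]
double-top zero = exit refl
double-top (suc v) {b} {i} {q} {f} {p} {x} =
  loop refl (pop ⨾ push ⨾ then refl (pop ⨾ push))
    (subst (λ xs → doubleTop ⊢ mem i q f (ticks (v + b) []) (ticks v (comma ∷ p)) (tick ∷ tick ∷ x) ⇒
                     ret (mem i q f (ticks b []) (comma ∷ p) xs) [ v * 8 + 1 ])
      eq (double-top v))
  where
  eq : ticks (v + v) (tick ∷ tick ∷ x) ≡ ticks (suc v + suc v) x
  eq rewrite +-suc v v = trans (ticks-∷ (v + v) (tick ∷ x)) (cong (tick ∷_) (ticks-∷ (v + v) x))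

double-top-fails : ∀ v b {i q f p x} → b < v →
  doubleTop ⊢ mem i q f (ticks b []) (ticks v (comma ∷ p)) x ⇒ done reject [ b * 8 + 5 ]
double-top-fails (suc v) zero    _         = abort refl (pop ⨾ push ⨾ else refl halt)
double-top-fails (suc v) (suc b) (s≤s b<v) =
  loop refl (pop ⨾ push ⨾ then refl (pop ⨾ push)) (double-top-fails v b b<v)

private
  sum-digit : ∀ v d → d + (v + v) ≡ v + (v + d)
  sum-digit = solve-∀

add-digit : ∀ d b {w q f p x} →
  addDigit ⊢ mem (digit d ∷ w) q f (ticks (value d + b) []) p x ⇒
    ret (mem (digit d ∷ w) q f (ticks b []) p (ticks (value d) x)) [ 9 ]
add-digit 𝟏 b = within (then refl (pop ⨾ push) ⨾ else refl skip) (m≤m+n _ 3)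
add-digit 𝟐 b = then refl (pop ⨾ push) ⨾ then refl (then refl (pop ⨾ push))

add-digit-fails : ∀ d b {w q f p x} → b < value d →
  addDigit ⊢ mem (digit d ∷ w) q f (ticks b []) p x ⇒ done reject [ 6 ]
add-digit-fails d zero          _ = within (stop (else refl halt)) (m≤m+n _ 5)
add-digit-fails 𝟏 (suc b) (s≤s ())
add-digit-fails 𝟐 (suc zero)    _ = then refl (pop ⨾ push) ⨾ then refl (else refl halt)
add-digit-fails 𝟐 (suc (suc b)) (s≤s (s≤s ()))

read-digit-runs : ∀ v d b {w q f p} →
  readDigit ⊢ mem (digit d ∷ w) q f (ticks (v + (value d + b)) []) (ticks v (comma ∷ p)) [] ⇒
    ret (mem w q f (ticks b []) (ticks (v + (v + value d)) (comma ∷ p)) []) [ (v + value d) * 16 + 13 ]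
read-digit-runs v d b {w} {q} {f} {p} =
  within
    (then (nonempty-ticks v comma p)
      (double-top v ⨾ add-digit d b ⨾ pop ⨾
        subst (λ xs → moveTicks X P ⊢ mem w q f (ticks b []) (comma ∷ p) xs ⇒
                        ret (mem w q f (ticks b []) (ticks v′ (comma ∷ p)) []) [ v′ * 4 + 1 ])
          (trans (cong (λ r → ticks r []) (sym (sum-digit v (value d)))) (ticks-+ (value d) (v + v) []))
          (move-ticks X→P v′ refl)))
    (≤-slack (value d * 12) (cost v (value d)))
  where
  v′ = v + (v + value d)
  cost : ∀ v d → 1 + (v * 8 + 1 + (9 + (1 + ((v + (v + d)) * 4 + 1)))) + d * 12 ≡ (v + d) * 16 + 13
  cost = solve-∀

read-digit-fails : ∀ v d b {w q f p} → b < v + value d →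
  readDigit ⊢ mem (digit d ∷ w) q f (ticks b []) (ticks v (comma ∷ p)) [] ⇒ done reject [ b * 8 + 8 ]
read-digit-fails v d b {p = p} b<v+d with v ≤? b
... | no v≰b  = within (then (nonempty-ticks v comma p) (stop (double-top-fails v b (≰⇒> v≰b)))) (≤-slack 2 (eq b))
  where
  eq : ∀ b → suc (b * 8 + 5) + 2 ≡ b * 8 + 8
  eq = solve-∀
... | yes v≤b with k , refl ← m≤n⇒∃[o]m+o≡n v≤b =
  within (then (nonempty-ticks v comma p)
           (double-top v ⨾ stop (add-digit-fails d k (+-cancelˡ-< v _ _ b<v+d))))
    (≤-slack (k * 8) (eq v k))
  where
  eq : ∀ v k → suc (v * 8 + 1 + 6) + k * 8 ≡ (v + k) * 8 + 8
  eq = solve-∀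

-- A potential: a comma uses up one unit of `c`, and a digit uses up `v + value d` of `b`. A digit
-- costs 16 per unit and 16 more, hence at most 32 per unit. The length of the word does not enter.
readCost : ℕ → ℕ → ℕ
readCost c b = (c + b) * 32 + 32

private
  comma-cost : ∀ c b → 7 + ((c + b) * 32 + 32) + 25 ≡ (1 + c + b) * 32 + 32
  comma-cost = solve-∀

  overflow-cost : ∀ c b → 3 + (b * 8 + 8) + (c * 32 + b * 24 + 21) ≡ (c + b) * 32 + 32
  overflow-cost = solve-∀

  digit-cost-≡ : ∀ c v d b →
    3 + ((v + (1 + d)) * 16 + 13 + ((c + b) * 32 + 32)) + (v + d) * 16 ≡ (c + (v + (1 + d + b))) * 32 + 32
  digit-cost-≡ = solve-∀

  digit-cost-≤ : ∀ c v d b → 3 + ((v + suc d) * 16 + 13 + readCost c b) ≤ readCost c (v + (suc d + b))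
  digit-cost-≤ c v d b = ≤-slack ((v + d) * 16) (digit-cost-≡ c v d b)

  -- Without a digit 0, every digit consumes some of the budget; this is what bounds the number of
  -- digits read.
  value-suc : ∀ d → ∃[ k ] (value d ≡ suc k)
  value-suc 𝟏 = 0 , refl
  value-suc 𝟐 = 1 , refl

  digit-cost : ∀ c v d b → 3 + ((v + value d) * 16 + 13 + readCost c b) ≤ readCost c (v + (value d + b))
  digit-cost c v d b =
    subst (λ x → 3 + ((v + x) * 16 + 13 + readCost c b) ≤ readCost c (v + (x + b)))
      (sym (proj₂ (value-suc d))) (digit-cost-≤ c v _ b)

-- A normal end only reduces `read` to the empty word; whether both counters have reached 0 is left
-- to `checkCounters`.
read-entries : ∀ w c b rs {q} → let σ = mem w q (ticks c []) (ticks b []) (numbers rs) [] in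
  (∃[ c′ ] ∃[ b′ ] ∃[ rs′ ]
    (readEntries ⊢ σ ⇒ ret (mem [] q (ticks c′ []) (ticks b′ []) (numbers rs′) []) [ readCost c b ]
     × read w c b rs ≡ read [] c′ b′ rs′))
  ⊎ (readEntries ⊢ σ ⇒ done reject [ readCost c b ] × read w c b rs ≡ nothing)
read-entries [] c b rs =
  inj₁ (c , b , rs , within (exit refl) (≤-trans (m≤m+n 1 31) (m≤n+m 32 ((c + b) * 32))) , refl)
read-entries (step s ∷ w) c b rs =
  inj₂ (within (abort refl (else refl (else refl halt))) (≤-trans (m≤m+n 3 29) (m≤n+m 32 ((c + b) * 32))) , refl)
read-entries (comma ∷ w) zero b rs =
  inj₂ (within (abort refl (then refl (else refl halt))) (≤-trans (m≤m+n 3 29) (m≤n+m 32 (b * 32))) , refl)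
read-entries (comma ∷ w) (suc c) b rs with read-entries w c b (0 ∷ rs)
... | inj₁ (c′ , b′ , rs′ , run , eq) =
  inj₁ (c′ , b′ , rs′ , within (loop refl (then refl (then refl (pop ⨾ pop ⨾ push))) run)
          (≤-slack 25 (comma-cost c b)) , eq)
... | inj₂ (run , eq) =
  inj₂ (within (loop refl (then refl (then refl (pop ⨾ pop ⨾ push))) run)
          (≤-slack 25 (comma-cost c b)) , eq)
read-entries (digit d ∷ w) c b [] =
  inj₂ (within (abort refl (else refl (then refl (else refl halt))))
          (≤-trans (m≤m+n 4 28) (m≤n+m 32 ((c + b) * 32))) , refl)
read-entries (digit d ∷ w) c b (v ∷ rs) with v + value d ≤? b
... | no ≰b =
  inj₂ (within (abort refl (else refl (then refl (read-digit-fails v d b (≰⇒> ≰b)))))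
          (≤-slack (c * 32 + b * 24 + 21) (overflow-cost c b)) , refl)
... | yes ≤b with k , refl ← m≤n⇒∃[o]m+o≡n ≤b rewrite m+n∸m≡n (v + value d) k | +-assoc v (value d) k
  with read-entries w c k (v + (v + value d) ∷ rs)
... | inj₁ (c′ , b′ , rs′ , run , eq) =
  inj₁ (c′ , b′ , rs′ , within (loop refl (else refl (then refl (read-digit-runs v d k))) run)
          (digit-cost c v d k) , eq)
... | inj₂ (run , eq) =
  inj₂ (within (loop refl (else refl (then refl (read-digit-runs v d k))) run)
          (digit-cost c v d k) , eq)

-- The greedy algorithm

-- Ticks are removed in pairs: the minimum collects on `Q`, `r` on `X`, and `m ∸ r` remains on `M`.
-- Adding the latter two gives the maximum.
splitTop compareTop select : Program
splitTop   = while P isTick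
  (pop P ⨾ push X tick ⨾ branch M isTick (pop M ⨾ push Q tick) skip)
compareTop = push Q comma ⨾ splitTop ⨾ moveTicks M X ⨾ pop P ⨾ moveTicks X M
select     = while P nonempty compareTop

split-top : ∀ m r {i q f p x} →
  splitTop ⊢ mem i q f (ticks m []) (ticks r (comma ∷ p)) x ⇒
    ret (mem i (ticks (m ⊓ r) q) f (ticks (m ∸ r) []) (comma ∷ p) (ticks r x)) [ r * 8 + 1 ]
split-top zero    zero    = exit refl
split-top (suc m) zero    = exit refl
split-top zero    (suc r) {i} {q} {f} {p} {x} =
  loop refl (within (pop ⨾ push ⨾ else refl skip) (m≤m+n 5 2))
    (subst (λ xs → splitTop ⊢ mem i q f [] (ticks r (comma ∷ p)) (tick ∷ x) ⇒
                     ret (mem i q f [] (comma ∷ p) xs) [ r * 8 + 1 ])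
      (ticks-∷ r x)
      (subst (λ m → splitTop ⊢ mem i q f [] (ticks r (comma ∷ p)) (tick ∷ x) ⇒
                     ret (mem i q f (ticks m []) (comma ∷ p) (ticks r (tick ∷ x))) [ r * 8 + 1 ])
        (0∸n≡0 r) (split-top zero r)))
split-top (suc m) (suc r) {i} {q} {f} {p} {x} =
  loop refl (within (pop ⨾ push ⨾ then refl (pop ⨾ push)) (m≤m+n 7 0))
    (subst₂ (λ xs ys → splitTop ⊢ mem i (tick ∷ q) f (ticks m []) (ticks r (comma ∷ p)) (tick ∷ x) ⇒
                     ret (mem i xs f (ticks (m ∸ r) []) (comma ∷ p) ys) [ r * 8 + 1 ])
      (ticks-∷ (m ⊓ r) q) (ticks-∷ r x) (split-top m r))

compare-top : ∀ m r {i f p ms} →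
  compareTop ⊢ mem i (numbers ms) f (ticks m []) (ticks r (comma ∷ p)) [] ⇒
    ret (mem i (numbers (m ⊓ r ∷ ms)) f (ticks (r + (m ∸ r)) []) p []) [ (r + (m ∸ r)) * 12 + 6 ]
compare-top m r {i} {f} {p} {ms} =
  within
    (push ⨾ split-top m r ⨾ move-ticks M→X (m ∸ r) refl ⨾ pop ⨾
      subst (λ xs → moveTicks X M ⊢ mem i (numbers (m ⊓ r ∷ ms)) f [] p xs ⇒
                      ret (mem i (numbers (m ⊓ r ∷ ms)) f (ticks (r + (m ∸ r)) []) p []) [ (r + (m ∸ r)) * 4 + 1 ])
        (trans (cong (λ k → ticks k []) (+-comm r (m ∸ r))) (ticks-+ (m ∸ r) r []))
        (move-ticks X→M (r + (m ∸ r)) refl))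
    (≤-slack ((m ∸ r) * 4) (cost r (m ∸ r)))
  where
  cost : ∀ r k → 2 + (r * 8 + 1 + (k * 4 + 1 + (1 + ((r + k) * 4 + 1)))) + k * 4 ≡ (r + k) * 12 + 6
  cost = solve-∀

m+[n∸m]≤n+m : ∀ m r → r + (m ∸ r) ≤ m + r
m+[n∸m]≤n+m m r = ≤-trans (+-monoʳ-≤ r (m∸n≤m m r)) (≤-reflexive (+-comm r m))

size-⊔ : ∀ m r rs {B} → m + size (r ∷ rs) ≤ B → r + (m ∸ r) + size rs ≤ B
size-⊔ m r rs h = ≤-trans (+-monoˡ-≤ (size rs) (m+[n∸m]≤n+m m r))
  (≤-trans (≤-trans (≤-reflexive (+-assoc m r _)) (+-monoʳ-≤ m (n≤1+n _))) h)

linear : ∀ c d {x y} → x ≤ y → x * c + d ≤ y * c + d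
linear c d x≤y = +-monoˡ-≤ d (*-monoˡ-≤ c x≤y)

-- The bound `B` persists because a maximum is at most the sum. Each comparison costs at most
-- `B * 12 + 7`, and there are at most `size rs` of them.
select-runs : ∀ m ms rs B {i f} → m + size rs ≤ B → let k , ks = extract m ms rs in
  select ⊢ mem i (numbers ms) f (ticks m []) (numbers rs) [] ⇒
    ret (mem i (numbers ks) f (ticks k []) [] []) [ size rs * (B * 12 + 7) + 1 ]
select-runs m ms []       B h = exit refl
select-runs m ms (r ∷ rs) B h =
  within
    (loop (nonempty-ticks r comma (numbers rs)) (compare-top m r {ms = ms})
      (select-runs (r + (m ∸ r)) (m ⊓ r ∷ ms) rs B (size-⊔ m r rs h)))
    (≤-trans (s≤s (+-monoˡ-≤ _ (linear 12 6 (m+n≤o⇒m≤o (r + (m ∸ r)) (size-⊔ m r rs h)))))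
      (≤-slack (r * (B * 12 + 7)) (cost r (size rs) B)))
  where
  cost : ∀ r z B → 1 + (B * 12 + 6 + (z * (B * 12 + 7) + 1)) + r * (B * 12 + 7) ≡ (1 + r + z) * (B * 12 + 7) + 1
  cost = solve-∀

-- The queue is a stack with its front on top, so retiring is a single move; adding at the back
-- turns the whole stack over onto `Q` and back again.
serveVertex retireVertex processPath checkExhausted : Program
serveVertex = pop I ⨾ branch P nonempty
  (moveTicks P M ⨾ pop P ⨾ select ⨾ branch M isTick
    (pop M ⨾ moveNumbers Q P ⨾ moveNumbers F Q ⨾ push Q comma ⨾ moveTicks M Q ⨾ moveNumbers Q F)
    (halt reject))
  (halt reject)
retireVertex = pop I ⨾ branch F nonempty (moveNumber F P) (halt reject)
processPath = while I nonempty (branch I is𝗇 serveVertex retireVertex)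
checkExhausted = branch F nonempty (halt reject)
  (while P isComma (pop P) ⨾ branch P nonempty (halt reject) (halt accept))

size-↭ : ∀ {rs rs′} → rs ↭ rs′ → size rs ≡ size rs′
size-↭ σ = sum-↭ (map⁺ suc σ)

size-∷ʳ : ∀ rs r → size (rs ∷ʳ r) ≡ suc r + size rs
size-∷ʳ rs r = size-↭ (↭-sym (∷↭∷ʳ r rs))

size-ʳ++[] : ∀ rs → size (rs ʳ++ []) ≡ size rs
size-ʳ++[] rs = size-↭ (ʳ++[]-↭ rs)

reverse-∷-reverse : ∀ (rs : List ℕ) r → (r ∷ (rs ʳ++ [])) ʳ++ [] ≡ rs ∷ʳ r
reverse-∷-reverse rs r = trans (ʳ++-defn (rs ʳ++ [])) (cong (_∷ʳ r) (reverse-involutive rs))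

-- Quadratic because of `select`, whose up to `S` comparisons cost `O(S)` each; the factor 40 is
-- generous.
stepCost : ℕ → ℕ
stepCost S = (S + 1) * (S + 1) * 40

serve-vertex : ∀ p r rs fs S → size (r ∷ rs) + size fs ≤ S →
  let σ = mem (step 𝗇 ∷ map step p) [] (numbers fs) [] (numbers (r ∷ rs)) [] in
  (∃[ rs′ ] ∃[ fs′ ]
    (serveVertex ⊢ σ ⇒ ret (mem (map step p) [] (numbers fs′) [] (numbers rs′) []) [ stepCost S ]
     × size rs′ + size fs′ ≤ S
     × greedy (𝗇 ∷ p) (r ∷ rs) fs ≡ greedy p rs′ fs′))
  ⊎ (serveVertex ⊢ σ ⇒ done reject [ stepCost S ] × greedy (𝗇 ∷ p) (r ∷ rs) fs ≡ reject)
serve-vertex p r rs fs S h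
  with extract r [] rs | extract-↭ r [] rs | select-runs r [] rs S {map step p} {numbers fs}
         (≤-trans (n≤1+n _) (m+n≤o⇒m≤o _ h))
... | zero , ks | σ | run =
  inj₂ (within (pop ⨾ then (nonempty-ticks r comma (numbers rs))
                 (within (move-ticks P→M r refl) (linear 4 1 r≤S) ⨾ pop ⨾
                  within run (linear _ 1 rs≤S) ⨾ else refl halt))
          (≤-slack (S * S * 28 + S * 69 + 34) (cost S)) , refl)
  where
  r≤S : r ≤ S
  r≤S = ≤-trans (≤-trans (m≤m+n r _) (n≤1+n _)) (m+n≤o⇒m≤o _ h)
  rs≤S : size rs ≤ S
  rs≤S = m+n≤o⇒n≤o (suc r) (m+n≤o⇒m≤o _ h)
  cost : ∀ S → 1 + (1 + (S * 4 + 1 + (1 + (S * (S * 12 + 7) + 1 + 1)))) + (S * S * 28 + S * 69 + 34)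
         ≡ (S + 1) * (S + 1) * 40
  cost = solve-∀
... | suc k , ks | σ | run =
  inj₁ (ks ʳ++ [] , fs ∷ʳ k
       , within
           (pop ⨾ then (nonempty-ticks r comma (numbers rs))
             (within (move-ticks P→M r refl) (linear 4 1 r≤S) ⨾ pop ⨾ within run (linear _ 1 rs≤S) ⨾ then refl
               (pop ⨾
                within (move-numbers Q→P ks) (linear 5 1 ks≤S) ⨾
                within (move-numbers F→Q fs {[]}) (linear 5 1 fs≤S) ⨾
                push ⨾
                within (move-ticks M→Q k refl) (linear 4 1 k≤S) ⨾
                subst (λ gs → moveNumbers Q F ⊢ mem (map step p) (numbers (k ∷ (fs ʳ++ []))) [] [] (numbers (ks ʳ++ [])) [] ⇒
                                ret (mem (map step p) [] (numbers gs) [] (numbers (ks ʳ++ [])) []) [ S * 5 + 1 ])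
                  (reverse-∷-reverse fs k)
                  (within (move-numbers Q→F (k ∷ (fs ʳ++ []))) (linear 5 1 k∷fs≤S)))))
           (≤-slack (S * S * 28 + S * 50 + 27) (cost S))
       , new≤S , refl)
  where
  r≤S : r ≤ S
  r≤S = ≤-trans (≤-trans (m≤m+n r _) (n≤1+n _)) (m+n≤o⇒m≤o _ h)
  rs≤S : size rs ≤ S
  rs≤S = m+n≤o⇒n≤o (suc r) (m+n≤o⇒m≤o _ h)
  total≤S : suc (suc k) + size ks + size fs ≤ S
  total≤S = subst (λ z → z + size fs ≤ S) (sym (size-↭ σ)) h
  ks≤S : size ks ≤ S
  ks≤S = m+n≤o⇒n≤o (suc (suc k)) (m+n≤o⇒m≤o _ total≤S)
  fs≤S : size fs ≤ S
  fs≤S = m+n≤o⇒n≤o (suc (suc k) + size ks) total≤S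
  k≤S : k ≤ S
  k≤S = ≤-trans (≤-trans (m≤m+n k _) (m≤n+m _ 2)) (m+n≤o⇒m≤o _ total≤S)
  reorder : ∀ x y z → y + (suc x + z) ≡ suc x + y + z
  reorder = solve-∀
  new≤S : size (ks ʳ++ []) + size (fs ∷ʳ k) ≤ S
  new≤S = ≤-trans (≤-reflexive (trans (cong₂ _+_ (size-ʳ++[] ks) (size-∷ʳ fs k))
            (reorder k (size ks) (size fs))))
            (≤-trans (n≤1+n _) total≤S)
  k∷fs≤S : size (k ∷ (fs ʳ++ [])) ≤ S
  k∷fs≤S = ≤-trans (≤-reflexive (trans (cong (suc k +_) (size-ʳ++[] fs)) (sym (size-∷ʳ fs k))))
             (m+n≤o⇒n≤o (size (ks ʳ++ [])) new≤S)
  cost : ∀ S → 1 + (1 + (S * 4 + 1 + (1 + (S * (S * 12 + 7) + 1 + (1 + (1 +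
           (S * 5 + 1 + (S * 5 + 1 + (2 + (S * 4 + 1 + (S * 5 + 1))))))))))) + (S * S * 28 + S * 50 + 27)
         ≡ (S + 1) * (S + 1) * 40
  cost = solve-∀

retire-vertex : ∀ p r rs fs S → size rs + size (r ∷ fs) ≤ S →
  retireVertex ⊢ mem (step 𝖾 ∷ map step p) [] (numbers (r ∷ fs)) [] (numbers rs) [] ⇒
    ret (mem (map step p) [] (numbers fs) [] (numbers (r ∷ rs)) []) [ stepCost S ]
retire-vertex p r rs fs S h =
  within (pop ⨾ then (nonempty-ticks r comma (numbers fs)) (within (move-number F→P r) (linear 4 4 r≤S)))
    (≤-slack (S * S * 40 + S * 76 + 34) (cost S))
  where
  r≤S : r ≤ S
  r≤S = ≤-trans (≤-trans (m≤m+n r _) (n≤1+n _)) (m+n≤o⇒n≤o (size rs) h)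
  cost : ∀ S → 1 + (1 + (S * 4 + 4)) + (S * S * 40 + S * 76 + 34) ≡ (S + 1) * (S + 1) * 40
  cost = solve-∀

retire-size : ∀ r rs fs {S} → size rs + size (r ∷ fs) ≤ S → size (r ∷ rs) + size fs ≤ S
retire-size r rs fs = ≤-trans (≤-reflexive (eq r (size rs) (size fs)))
  where
  eq : ∀ r z w → suc r + z + w ≡ z + (suc r + w)
  eq = solve-∀

2≤stepCost : ∀ S → 2 ≤ stepCost S
2≤stepCost S = ≤-slack (S * S * 40 + S * 80 + 38) (eq S)
  where
  eq : ∀ S → 2 + (S * S * 40 + S * 80 + 38) ≡ (S + 1) * (S + 1) * 40
  eq = solve-∀

private
  loop-cost : ∀ c l → 1 + (1 + c + (l * (c + 2) + 1)) ≡ c + 2 + l * (c + 2) + 1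
  loop-cost = solve-∀

  abort-cost : ∀ c l {t} → t ≤ c → 2 + t ≤ c + 2 + l * (c + 2) + 1
  abort-cost c l t≤ = ≤-trans (+-monoʳ-≤ 2 t≤) (≤-trans (≤-reflexive (+-comm 2 c))
    (≤-trans (m≤m+n _ (l * (c + 2))) (m≤m+n _ 1)))

-- The variable bound `C` keeps the polynomial `stepCost S` out of the arithmetic of the loop.
process-path : ∀ {S C} → stepCost S ≤ C → ∀ p rs fs → size rs + size fs ≤ S →
  let σ = mem (map step p) [] (numbers fs) [] (numbers rs) []
      t = length p * (C + 2) + 1 in
  (∃[ rs′ ] ∃[ fs′ ]
    (processPath ⊢ σ ⇒ ret (mem [] [] (numbers fs′) [] (numbers rs′) []) [ t ]
     × size rs′ + size fs′ ≤ S
     × greedy p rs fs ≡ greedy [] rs′ fs′))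
  ⊎ (processPath ⊢ σ ⇒ done reject [ t ] × greedy p rs fs ≡ reject)
process-path cost [] rs fs h = inj₁ (rs , fs , exit refl , h , refl)
process-path {S} {C} cost (𝗇 ∷ p) [] fs h =
  inj₂ (within (abort refl (then refl (pop ⨾ else refl halt)))
          (abort-cost C (length p) (≤-trans (2≤stepCost S) cost)) , refl)
process-path {S} {C} cost (𝗇 ∷ p) (r ∷ rs) fs h with serve-vertex p r rs fs S h
... | inj₂ (run , eq) =
  inj₂ (within (abort refl (then refl (within run cost))) (abort-cost C (length p) ≤-refl) , eq)
... | inj₁ (rs₁ , fs₁ , run , h₁ , eq) with process-path cost p rs₁ fs₁ h₁
...   | inj₁ (rs₂ , fs₂ , run′ , h₂ , eq′) =
  inj₁ (rs₂ , fs₂ , within (loop refl (then refl (within run cost)) run′) (≤-reflexive (loop-cost C (length p)))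
       , h₂ , trans eq eq′)
...   | inj₂ (run′ , eq′) =
  inj₂ (within (loop refl (then refl (within run cost)) run′) (≤-reflexive (loop-cost C (length p))) , trans eq eq′)
process-path {S} {C} cost (𝖾 ∷ p) rs [] h =
  inj₂ (within (abort refl (else refl (pop ⨾ else refl halt)))
          (abort-cost C (length p) (≤-trans (2≤stepCost S) cost)) , refl)
process-path {S} {C} cost (𝖾 ∷ p) rs (r ∷ fs) h with process-path cost p (r ∷ rs) fs (retire-size r rs fs h)
... | inj₁ (rs₂ , fs₂ , run′ , h₂ , eq′) =
  inj₁ (rs₂ , fs₂ , within (loop refl (else refl (within (retire-vertex p r rs fs S h) cost)) run′)
                      (≤-reflexive (loop-cost C (length p))) , h₂ , eq′)
... | inj₂ (run′ , eq′) =
  inj₂ (within (loop refl (else refl (within (retire-vertex p r rs fs S h) cost)) run′)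
          (≤-reflexive (loop-cost C (length p))) , eq′)

pop-commas : ∀ rs → let σ = mem [] [] [] [] (numbers rs) [] in
  ∃[ rs′ ] (while P isComma (pop P) ⊢ σ ⇒ ret (mem [] [] [] [] (numbers rs′) []) [ size rs * 2 + 1 ]
            × ((rs′ ≡ [] × exhausted rs ≡ accept) ⊎ (∃[ r ] ∃[ rs″ ] (rs′ ≡ suc r ∷ rs″ × exhausted rs ≡ reject))))
pop-commas []           = [] , exit refl , inj₁ (refl , refl)
pop-commas (suc r ∷ rs) = _ , within (exit refl) (m≤n+m 1 (size (suc r ∷ rs) * 2)) , inj₂ (r , rs , refl , refl)
pop-commas (zero ∷ rs) with rs′ , run , res ← pop-commas rs = rs′ , loop refl pop run , res

private
  final-cost : ∀ z → 1 + (z * 2 + 1 + 1) ≡ z * 2 + 3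
  final-cost = solve-∀

check-exhausted : ∀ rs fs →
  checkExhausted ⊢ mem [] [] (numbers fs) [] (numbers rs) [] ⇒ done (greedy [] rs fs) [ size rs * 2 + 3 ]
check-exhausted rs (f ∷ fs) =
  within (then (nonempty-ticks f comma (numbers fs)) halt) (≤-trans (m≤m+n 1 2) (m≤n+m 3 _))
check-exhausted rs [] with pop-commas rs
... | _ , run , inj₁ (refl , eq) rewrite eq =
  within (else refl (run ⨾ else refl halt)) (≤-reflexive (final-cost (size rs)))
... | _ , run , inj₂ (_ , _ , refl , eq) rewrite eq =
  within (else refl (run ⨾ then refl halt)) (≤-reflexive (final-cost (size rs)))

-- With both counters starting at the number of 𝗇 steps, the pool has twice that size; this is the
-- source of `k + k` below.
read-size : ∀ w c b rs {rs′} → read w c b rs ≡ just rs′ → size rs′ ≡ size rs + (c + b)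
read-size []            zero    zero rs refl = sym (+-identityʳ _)
read-size (comma ∷ w)   (suc c) b rs eq = trans (read-size w c b (0 ∷ rs) eq) (sym (+-suc (size rs) (c + b)))
read-size (digit d ∷ w) c       b (v ∷ rs) eq with v + value d ≤? b
... | yes v+d≤b = trans (read-size w c _ (v + (v + value d) ∷ rs) eq)
  (trans (eq′ v (v + value d) (size rs) c (b ∸ (v + value d)))
    (cong (λ b → suc v + size rs + (c + b)) (m+[n∸m]≡n v+d≤b)))
  where
  eq′ : ∀ v x z c k → suc (v + x) + z + (c + k) ≡ suc v + z + (c + (x + k))
  eq′ = solve-∀

-- The complete program and its running time

judge : List Step → Maybe (List ℕ) → Verdict
judge p nothing   = reject
judge p (just rs) = greedy p rs []

decide : List Step → List Letter → Verdict
decide p w = judge p (read w (#[ 𝗇 ] p) (#[ 𝗇 ] p) [])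

main : Program
main = storePath ⨾ readEntries ⨾ checkCounters ⨾ restorePath ⨾ processPath ⨾ checkExhausted

finish-run : ∀ {S C} → stepCost S ≤ C → ∀ p rs → size rs ≤ S →
  processPath ⨾ checkExhausted ⊢ mem (map step p) [] [] [] (numbers rs) [] ⇒
    done (greedy p rs []) [ length p * (C + 2) + 1 + (S * 2 + 3) ]
finish-run cost p rs h with process-path cost p rs [] (≤-trans (≤-reflexive (+-identityʳ _)) h)
... | inj₁ (rs′ , fs′ , run , h′ , eq) rewrite eq =
  run ⨾ within (check-exhausted rs′ fs′) (linear 2 3 (m+n≤o⇒m≤o (size rs′) h′))
... | inj₂ (run , eq) rewrite eq = within (stop run) (m≤m+n _ _)

restore-run : ∀ {S C} → stepCost S ≤ C → ∀ p rs → size rs ≤ S →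
  restorePath ⨾ processPath ⨾ checkExhausted ⊢ mem [] (map step (reverse p)) [] [] (numbers rs) [] ⇒
    done (greedy p rs []) [ length p * 5 + 1 + (length p * (C + 2) + 1 + (S * 2 + 3)) ]
restore-run cost p rs h =
  subst₂ (λ p′ k → restorePath ⊢ mem [] (map step (reverse p)) [] [] (numbers rs) [] ⇒
                     ret (mem (map step p′) [] [] [] (numbers rs) []) [ k * 5 + 1 ])
    (reverse-involutive p) (length-reverse p) (restore-path (reverse p))
  ⨾ finish-run cost p rs h

read-run : ∀ {k S C} → k + k ≤ S → stepCost S ≤ C → ∀ p w →
  readEntries ⨾ checkCounters ⨾ restorePath ⨾ processPath ⨾ checkExhausted ⊢
    mem w (map step (reverse p)) (ticks k []) (ticks k []) [] [] ⇒
    done (judge p (read w k k []))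
    [ S * 32 + 32 + (3 + (length p * 5 + 1 + (length p * (C + 2) + 1 + (S * 2 + 3)))) ]
read-run {k} k+k≤S cost p w with read-entries w k k []
... | inj₂ (run , eq) rewrite eq =
  within (stop run) (≤-trans (linear 32 32 k+k≤S) (m≤m+n _ _))
... | inj₁ (suc _ , _ , _ , run , eq) rewrite eq =
  within run (linear 32 32 k+k≤S) ⨾ within (stop (then refl halt)) (m≤m+n 1 _)
... | inj₁ (zero , suc _ , _ , run , eq) rewrite eq =
  within run (linear 32 32 k+k≤S) ⨾ within (stop (else refl (then refl halt))) (m≤m+n 2 _)
... | inj₁ (zero , zero , rs , run , eq) rewrite eq =
  within run (linear 32 32 k+k≤S) ⨾ else refl (else refl skip) ⨾
  restore-run cost p rs (≤-trans (≤-reflexive (read-size w k k [] eq)) k+k≤S)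

cubic : (a b c e l : ℕ) → ℕ
cubic a b c e l = l * l * l * a + l * l * b + l * c + e

time : ℕ → ℕ
time = cubic 160 160 124 41

main-runs : ∀ p w → isStep (List.head w) ≡ false →
  main ⊢ mem (map step p ++ w) [] [] [] [] [] ⇒ done (decide p w) [ time (length p) ]
main-runs p w eq =
  within (store-path p eq ⨾ read-run (+-mono-≤ k≤l k≤l) ≤-refl p w) (≤-reflexive (total l))
  where
  l = length p
  k≤l : #[ 𝗇 ] p ≤ l
  k≤l = length-filter (_≟ˢ 𝗇) p
  total : ∀ l → l * 9 + 1 + ((l + l) * 32 + 32 + (3 + (l * 5 + 1 +
            (l * ((l + l + 1) * (l + l + 1) * 40 + 2) + 1 + ((l + l) * 2 + 3)))))
       ≡ l * l * l * 160 + l * l * 160 + l * 124 + 41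
  total = solve-∀

cubic-mono : ∀ a b c e {k l} → k ≤ l → cubic a b c e k ≤ cubic a b c e l
cubic-mono a b c e k≤l = +-monoˡ-≤ e (+-mono-≤ (+-mono-≤
  (*-monoˡ-≤ a (*-mono-≤ (*-mono-≤ k≤l k≤l) k≤l))
  (*-monoˡ-≤ b (*-mono-≤ k≤l k≤l))) (*-monoˡ-≤ c k≤l))

cubic-bound : (a b c e : ℕ) → ℕ
cubic-bound a b c e = a * 8 + b * 4 + c * 2 + e

-- The argument is at most `x + x` so that one lemma serves both bounds: the path of an instance has
-- length `2n`, and that of any word at most the length of the word. The factors 8, 4, 2 are the
-- powers of that 2.
cubic-≤ : ∀ a b c e {k} x → k ≤ x + x → cubic a b c e k ≤ cubic-bound a b c e * x ^ 3 + cubic-bound a b c e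
cubic-≤ a b c e {k} x k≤ = begin
  cubic a b c e k                      ≤⟨ cubic-mono a b c e k≤ ⟩
  cubic a b c e (x + x)                ≡⟨ double a b c e x ⟩
  x³ * (a * 8) + x * x * (b * 4) + x * (c * 2) + e
    ≤⟨ +-mono-≤ (+-mono-≤ (+-monoʳ-≤ (x³ * (a * 8)) (*-monoˡ-≤ (b * 4) x²≤x³))
                          (*-monoˡ-≤ (c * 2) (≤-trans (x≤x*x x) x²≤x³)))
         -- Pads the constant term so that the sum becomes `K * x³ + K`.
         (m≤n+m e (x³ * e + (a * 8 + b * 4 + c * 2))) ⟩
  x³ * (a * 8) + x³ * (b * 4) + x³ * (c * 2) + (x³ * e + (a * 8 + b * 4 + c * 2) + e)
    ≡⟨ collect a b c e x³ ⟩
  K * x³ + K                           ≡⟨ cong (λ y → K * y + K) cube ⟨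
  K * x ^ 3 + K                        ∎
  where
  open ≤-Reasoning
  x³ = x * x * x
  K = cubic-bound a b c e
  cube : x ^ 3 ≡ x * x * x
  cube = trans (cong (λ y → x * (x * y)) (*-identityʳ x)) (sym (*-assoc x x x))
  x≤x*x : ∀ x → x ≤ x * x
  x≤x*x zero    = z≤n
  x≤x*x (suc x) = m≤m+n (suc x) _
  x²≤x³ : x * x ≤ x * x * x
  x²≤x³ = ≤-trans (*-monoʳ-≤ x (x≤x*x x)) (≤-reflexive (sym (*-assoc x x x)))
  double : ∀ a b c e x → (x + x) * (x + x) * (x + x) * a + (x + x) * (x + x) * b + (x + x) * c + e
           ≡ x * x * x * (a * 8) + x * x * (b * 4) + x * (c * 2) + e
  double = solve-∀
  collect : ∀ a b c e y → y * (a * 8) + y * (b * 4) + y * (c * 2) + (y * e + (a * 8 + b * 4 + c * 2) + e)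
            ≡ (a * 8 + b * 4 + c * 2 + e) * y + (a * 8 + b * 4 + c * 2 + e)
  collect = solve-∀

-- Abstract because the multiples of a numeral unfold to that many summands.
abstract
  timeFactor : ℕ
  timeFactor = cubic-bound 160 160 124 41

  time-≤ : ∀ {k} x → k ≤ x + x → time k ≤ timeFactor * x ^ 3 + timeFactor
  time-≤ = cubic-≤ 160 160 124 41

-- Correctness of the decision on arbitrary words

split-path : ∀ w → ∃[ p ] ∃[ u ] (w ≡ map step p ++ u × isStep (List.head u) ≡ false)
split-path []            = [] , [] , refl , refl
split-path (step s ∷ w)  with p , u , refl , eq ← split-path w = s ∷ p , u , refl , eq
split-path (digit d ∷ w) = [] , _ , refl , refl
split-path (comma ∷ w)   = [] , _ , refl , refl

split-unique : ∀ p p′ {u u′} → isStep (List.head u) ≡ false → isStep (List.head u′) ≡ false →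
               map step p ++ u ≡ map step p′ ++ u′ → p ≡ p′ × u ≡ u′
split-unique []      []       _  _  eq   = refl , eq
split-unique []      (_ ∷ _)  () _  refl
split-unique (_ ∷ _) []       _  () refl
split-unique (s ∷ p) (s′ ∷ p′) h h′ eq with refl , eq′ ← ∷-injective eq
  with refl , refl ← split-unique p p′ h h′ eq′ = refl , refl

entries-isStep : ∀ vs → isStep (List.head (entries vs)) ≡ false
entries-isStep []      = refl
entries-isStep (_ ∷ _) = refl

-- Nothing is assumed about `p` or `w`: the success of `read` supplies the weight and the feasible
-- run supplies the Dyck path.
decide-sound : ∀ p w → decide p w ≡ accept → NonvanishingLanguage (map step p ++ w)
decide-sound p w eq with read w (#[ 𝗇 ] p) (#[ 𝗇 ] p) [] in read-eq
... | just rs with e , l ← read-sound w _ _ [] read-eq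
  with α , α≡ ← fromList′ (reverse rs) (trans (length-reverse rs) l) =
  inst (#[ 𝗇 ] p) path α , cong (map step p ++_) (trans (cong entries α≡) (sym e))
  , feasible⇒nonvanishing path α (subst (λ pool → Feasible p pool []) (sym α≡)
      (Feasible-resp-↭ (↭-sym (↭-reverse rs)) f))
  where
  f : Feasible p rs []
  f = greedy-sound p rs [] eq
  path : DyckPath (#[ 𝗇 ] p)
  path = record { steps = p ; norths = refl ; easts = feasible-easts f ; diagonal = feasible-diagonal f }

decide-complete : ∀ x → Nonvanishing x → decide (steps (d x)) (entries (toList (α x))) ≡ accept
decide-complete (inst n d α) nv = begin
  judge p (read (entries vs) (#[ 𝗇 ] p) (#[ 𝗇 ] p) [])
    -- The entry counter agrees with the length of the weight by its type, the budget with its total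
    -- by feasibility.
    ≡⟨ cong₂ (λ c b → judge p (read (entries vs) c b []))
         (trans (norths d) (sym (Vec.length-toList α)))
         (trans (sym (feasible-sum f)) (cong sum (++-identityʳ vs))) ⟩
  judge p (read (entries vs) (length vs) (sum vs) [])
    ≡⟨ cong (judge p) (read-complete vs []) ⟩
  greedy p (reverse vs) []
    ≡⟨ greedy-complete (Feasible-resp-↭ (↭-sym (↭-reverse vs)) f) ⟩
  accept ∎
  where
  open ≡-Reasoning
  p  = steps d
  vs = toList α
  f  = nonvanishing⇒feasible d α nv

decide-correct : ∀ p w → isStep (List.head w) ≡ false →
                 decide p w ≡ accept ⇔ NonvanishingLanguage (map step p ++ w)
decide-correct p w h = mk⇔ (decide-sound p w) λ where
  (x , eq , nv) → let p≡ , w≡ = split-unique (steps (d x)) p (entries-isStep (toList (α x))) h eq in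
    subst₂ (λ p w → decide p w ≡ accept) p≡ w≡ (decide-complete x nv)

length-steps : ∀ p → length p ≡ #[ 𝗇 ] p + #[ 𝖾 ] p
length-steps []      = refl
length-steps (𝗇 ∷ p) = cong suc (length-steps p)
length-steps (𝖾 ∷ p) = trans (cong suc (length-steps p)) (sym (+-suc _ _))

decides : ∀ w → ∃[ v ] ∃[ t ] (main ⊢ mem w [] [] [] [] [] ⇒ done v [ t ] × (v ≡ accept ⇔ NonvanishingLanguage w))
decides w with p , u , refl , h ← split-path w = _ , _ , main-runs p u h , decide-correct p u h

polynomial-in-length : ∀ w → ∃[ v ] ∃[ t ]
  (main ⊢ mem w [] [] [] [] [] ⇒ done v [ t ] × t ≤ timeFactor * length w ^ 3 + timeFactor)
polynomial-in-length w with p , u , refl , h ← split-path w =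
  _ , _ , main-runs p u h , time-≤ (length (map step p ++ u)) (≤-trans l≤ (m≤m+n _ _))
  where
  l≤ : length p ≤ length (map step p ++ u)
  l≤ = ≤-trans (≤-reflexive (sym (length-map step p))) (length-++-≤ˡ (map step p))

polynomial-in-n : ∀ x → ∃[ v ] ∃[ t ]
  (main ⊢ mem (encode x) [] [] [] [] [] ⇒ done v [ t ] × t ≤ timeFactor * n x ^ 3 + timeFactor)
polynomial-in-n (inst n d α) =
  _ , _ , main-runs (steps d) (entries (toList α)) (entries-isStep (toList α))
  , time-≤ n (≤-reflexive (trans (length-steps (steps d)) (cong₂ _+_ (norths d) (easts d))))

proposition7p9 : Σ[ M ∈ TM Letter ]
    Decides M NonvanishingLanguage
    × PolynomialTime M id length
    × PolynomialTime M encode n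
proposition7p9 = Compile.machine main
  , program-decides main NonvanishingLanguage decides
  , program-polynomial main id length timeFactor 3 polynomial-in-length
  , program-polynomial main encode n timeFactor 3 polynomial-in-n
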